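{- For every real $c>0$, there exist infinitely many pairs $(m,n)\in\mathbb{N}^2$ such that $$1 \leq \sum_{\ell=n}^{m}\frac{1}{\ell} \leq 1+\frac{c}{n^2}.$$
   Context: $\mathbb{N}$ denotes the set of positive integers. -}

module Defs where

open import Data.Integer.Base using (+_)
open import Data.List.Base using (List)
open import Data.List.Membership.Propositional using (_∉_)
open import Data.Nat.Base as ℕ using (ℕ; zero; suc)
import Data.Nat.Properties as ℕ
open import Data.Product.Base using (_×_; _,_; ∃-syntax)
open import Data.Rational.Base
import Data.Rational.Properties as ℚ
open import Data.Rational.Solver using (module +-*-Solver)
open import Relation.Binary.PropositionalEquality

-- "Infinitely many x satisfy P", read positively: no finite list
-- exhausts the solutions, and a missing one can be exhibited.

InfinitelyMany : {A : Set} → (A → Set) → Set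
InfinitelyMany {A} P = (xs : List A) → ∃[ x ] (x ∉ xs × P x)

record ℕ⁺ : Set where
  constructor mkℕ⁺
  field
    value        : ℕ
    .{{value≢0}} : ℕ.NonZero value

open ℕ⁺ public using (value)

_^⁺_ : ℕ⁺ → ℕ → ℕ⁺
mkℕ⁺ n ^⁺ k = mkℕ⁺ (n ℕ.^ k) {{ℕ.m^n≢0 n k}}

1/⁺_ : ℕ⁺ → ℚ
1/⁺ mkℕ⁺ n = + 1 / n

-- 1/n + 1/(n+1) + ⋯ + 1/(n+k-1)

sumOfReciprocals : ℕ⁺ → ℕ → ℚ
sumOfReciprocals n zero    = 0ℚ
sumOfReciprocals n (suc k) = 1/⁺ n + sumOfReciprocals (mkℕ⁺ (suc (value n))) k

-- ∑_{ℓ=n}^{m} 1/ℓ, which has (m+1)∸n terms (none when m < n).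

∑1/ℓ[ℓ=_⋯_] : ℕ⁺ → ℕ⁺ → ℚ
∑1/ℓ[ℓ= n ⋯ m ] = sumOfReciprocals n (suc (value m) ℕ.∸ value n)

-- Real numbers as Cauchy sequences of rationals.  Two sequences denote
-- the same real when each is ≤ℝ the other.

IsCauchy : (ℕ → ℚ) → Set
IsCauchy x = ∀ ε → 0ℚ < ε →
  ∃[ N ] (∀ i j → N ℕ.≤ i → N ℕ.≤ j → ∣ x i - x j ∣ < ε)

record ℝ : Set where
  constructor mkℝ
  field
    seq    : ℕ → ℚ
    cauchy : IsCauchy seq

open ℝ public

infix 4 _≤ℝ_ _<ℝ_

_≤ℝ_ : ℝ → ℝ → Set
x ≤ℝ y = ∀ ε → 0ℚ < ε → ∃[ N ] (∀ i → N ℕ.≤ i → seq x i ≤ seq y i + ε)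

_<ℝ_ : ℝ → ℝ → Set
x <ℝ y = ∃[ ε ] (0ℚ < ε × ∃[ N ] (∀ i → N ℕ.≤ i → seq x i + ε ≤ seq y i))

fromℚ : ℚ → ℝ
fromℚ q = mkℝ (λ _ → q) λ ε 0<ε →
  0 , λ _ _ _ _ → subst (_< ε) (sym (cong ∣_∣ (ℚ.+-inverseʳ q))) 0<ε

0ℝ 1ℝ : ℝ
0ℝ = fromℚ 0ℚ
1ℝ = fromℚ 1ℚ

infixl 6 _+ℝ_

_+ℝ_ : ℝ → ℝ → ℝ
mkℝ x cx +ℝ mkℝ y cy = mkℝ (λ i → x i + y i) cauchy′
  where
  open ℚ.≤-Reasoning

  rearrange : ∀ a b c d → (a + b) - (c + d) ≡ (a - c) + (b - d)
  rearrange = solve 4 (λ a b c d →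
    (a :+ b) :- (c :+ d) := (a :- c) :+ (b :- d)) refl
    where open +-*-Solver

  halves : ∀ ε → ε * ½ + ε * ½ ≡ ε
  halves ε = trans (sym (ℚ.*-distribˡ-+ ε ½ ½)) (ℚ.*-identityʳ ε)

  cauchy′ : IsCauchy (λ i → x i + y i)
  cauchy′ ε 0<ε
    with 0<ε/2 ← ℚ.*-monoˡ-<-pos ½ 0<ε
    with M , hx ← cx (ε * ½) 0<ε/2
    with N , hy ← cy (ε * ½) 0<ε/2
    = M ℕ.⊔ N , λ i j p q → begin-strict
      ∣ (x i + y i) - (x j + y j) ∣      ≡⟨ cong ∣_∣ (rearrange (x i) (y i) (x j) (y j)) ⟩
      ∣ (x i - x j) + (y i - y j) ∣      ≤⟨ ℚ.∣p+q∣≤∣p∣+∣q∣ (x i - x j) (y i - y j) ⟩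
      ∣ x i - x j ∣ + ∣ y i - y j ∣      <⟨ ℚ.+-mono-< (hx i j (ℕ.m⊔n≤o⇒m≤o M N p) (ℕ.m⊔n≤o⇒m≤o M N q))
                                                      (hy i j (ℕ.m⊔n≤o⇒n≤o M N p) (ℕ.m⊔n≤o⇒n≤o M N q)) ⟩
      ε * ½ + ε * ½                      ≡⟨ halves ε ⟩
      ε                                  ∎

infixl 7 _/ℝ_

_/ℝ_ : ℝ → ℕ⁺ → ℝ
mkℝ x cx /ℝ k@(mkℕ⁺ n) = mkℝ (λ i → x i * r) cauchy′
  where
  open ℚ.≤-Reasoning

  r : ℚ
  r = 1/⁺ k

  instance
    r-pos : Positive r
    r-pos = ℚ.normalize-pos 1 n

    r-nonNeg : NonNegative r
    r-nonNeg = ℚ.pos⇒nonNeg r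

    r≢0 : NonZero r
    r≢0 = ℚ.pos⇒nonZero r

    1/r-pos : Positive (1/ r)
    1/r-pos = ℚ.1/pos⇒pos r

  factor : ∀ a b → a * r - b * r ≡ (a - b) * r
  factor a b = solve 3 (λ a b r → a :* r :- b :* r := (a :- b) :* r) refl a b r
    where open +-*-Solver

  cancel : ∀ ε → ε * 1/ r * r ≡ ε
  cancel ε = trans (ℚ.*-assoc ε (1/ r) r)
    (trans (cong (ε *_) (ℚ.*-inverseˡ r)) (ℚ.*-identityʳ ε))

  cauchy′ : IsCauchy (λ i → x i * r)
  cauchy′ ε 0<ε
    with N , hx ← cx (ε * 1/ r)
           (subst (_< ε * 1/ r) (ℚ.*-zeroˡ (1/ r)) (ℚ.*-monoˡ-<-pos (1/ r) 0<ε))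
    = N , λ i j p q → begin-strict
      ∣ x i * r - x j * r ∣  ≡⟨ cong ∣_∣ (factor (x i) (x j)) ⟩
      ∣ (x i - x j) * r ∣    ≡⟨ ℚ.∣p*q∣≡∣p∣*∣q∣ (x i - x j) r ⟩
      ∣ x i - x j ∣ * ∣ r ∣  ≡⟨ cong (∣ x i - x j ∣ *_) (ℚ.0≤p⇒∣p∣≡p (ℚ.nonNegative⁻¹ r)) ⟩
      ∣ x i - x j ∣ * r      <⟨ ℚ.*-monoˡ-<-pos r (hx i j p q) ⟩
      ε * 1/ r * r           ≡⟨ cancel ε ⟩
      ε                      ∎

{-# OPTIONS --safe #-}

-- Let p/q be a Padé approximant of e with p and q odd and p > q e, so that log(p/q) exceeds 1 by
-- o(1/q²).  For odd K put N = K q, M = K p, and let S(K) be the sum of the 1/ℓ with N < 2ℓ < M, a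
-- midpoint sum for the integral log(M/N) = log(p/q) that is too small by about 1/N².  Hence S(K) < 1
-- for a fixed K once the approximant is good enough, while S(K) → log(p/q) > 1 as K → ∞.  At the
-- first crossing S(K) < 1 ≤ S(K+2) the excess over 1 is at most S(K+2) - S(K) = O(1/(K N²)), and K
-- may be taken as large as we please.  Logarithms are avoided by exponentiating with truncations
-- of the exponential series.

module Submission where

open import Defs
open import Data.Integer.Base as ℤ using (-[1+_])
import Data.Integer.Properties as ℤ
open import Data.List.Base using (List; []; _∷_)
open import Data.List.Membership.Propositional using (_∈_; _∉_)
open import Data.List.Relation.Unary.Any using (here; there)
open import Data.Nat.Base as ℕ using (ℕ; zero; suc; _!)
import Data.Nat.Properties as ℕ
open import Data.Nat.Properties using (_!≢0)
import Data.Nat.Tactic.RingSolver as ℕ-Solver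
open import Data.Product.Base using (_×_; _,_; ∃-syntax; proj₁; proj₂)
open import Data.Rational.Base
import Data.Rational.Properties as ℚ
import Data.Rational.Unnormalised.Base as ℚᵘ
import Data.Rational.Unnormalised.Properties as ℚᵘ
open import Data.Sum.Base using (inj₁; inj₂)
open import Relation.Binary.PropositionalEquality
open import Relation.Nullary.Decidable.Core using (yes; no; dec⇒maybe)
open import Relation.Nullary.Negation.Core using (¬_; contradiction)
open import Tactic.RingSolver using (solve-∀)
open import Tactic.RingSolver.Core.AlmostCommutativeRing using (AlmostCommutativeRing; fromCommutativeRing)

-- For fixed K the deficit of S(K) is of order 1/(K² q²), so S(K) < 1 needs p - q e well below 1/(K²
-- q). Approximation of order 1/q² alone would cap K. The cap disappears because consecutive Padé
-- approximants straddle e and have determinant 2, whence p - q e ≤ 2/q′ for the next denominator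
-- q′, while q′/q is unbounded, the recurrence having growing coefficients 4k+6. Oddness of p, q and
-- K makes N/2 and M/2 half-integers, so the sum runs over the midpoints of whole unit cells. The
-- step from K to K+2 drops q terms at the bottom and gains p terms at the top; both groups
-- approximate the same log((K+2)/K), so only a third-order error is left.

ℚ-ring : AlmostCommutativeRing _ _
ℚ-ring = fromCommutativeRing ℚ.+-*-commutativeRing (λ x → dec⇒maybe (0ℚ ℚ.≟ x))

-- Order arithmetic in ℚ, and natural numbers as rationals

≤-from-+ : ∀ {x y d} → 0ℚ ≤ d → x + d ≡ y → x ≤ y
≤-from-+ {x} {d = d} 0≤d refl = subst (_≤ x + d) (ℚ.+-identityʳ x) (ℚ.+-monoʳ-≤ x 0≤d)

0≤y-x : ∀ {x y} → x ≤ y → 0ℚ ≤ y - x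
0≤y-x {x} {y} x≤y = subst (_≤ y - x) (ℚ.+-inverseʳ x) (ℚ.+-monoˡ-≤ (- x) x≤y)

+-≥0 : ∀ {x y} → 0ℚ ≤ x → 0ℚ ≤ y → 0ℚ ≤ x + y
+-≥0 = ℚ.+-mono-≤

*-monoˡ : ∀ {x y z} → 0ℚ ≤ z → x ≤ y → x * z ≤ y * z
*-monoˡ {z = z} 0≤z = ℚ.*-monoʳ-≤-nonNeg z {{nonNegative 0≤z}}

*-monoʳ : ∀ {x y z} → 0ℚ ≤ z → x ≤ y → z * x ≤ z * y
*-monoʳ {z = z} 0≤z = ℚ.*-monoˡ-≤-nonNeg z {{nonNegative 0≤z}}

*-≥0 : ∀ {x y} → 0ℚ ≤ x → 0ℚ ≤ y → 0ℚ ≤ x * y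
*-≥0 {x} {y} 0≤x 0≤y = subst (_≤ x * y) (ℚ.*-zeroˡ y) (*-monoˡ 0≤y 0≤x)

*->0 : ∀ {x y} → 0ℚ < x → 0ℚ < y → 0ℚ < x * y
*->0 {x} {y} 0<x 0<y =
  subst (_< x * y) (ℚ.*-zeroˡ y) (ℚ.*-monoˡ-<-pos y {{positive 0<y}} 0<x)

*-mono : ∀ {x y z w} → 0ℚ ≤ x → x ≤ y → 0ℚ ≤ z → z ≤ w → x * z ≤ y * w
*-mono 0≤x x≤y 0≤z z≤w =
  ℚ.≤-trans (*-monoˡ 0≤z x≤y) (*-monoʳ (ℚ.≤-trans 0≤x x≤y) z≤w)

*-cancelʳ : ∀ {x y z} → 0ℚ < z → x * z ≤ y * z → x ≤ y
*-cancelʳ {z = z} 0<z = ℚ.*-cancelʳ-≤-pos z {{positive 0<z}}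

0≤1 : 0ℚ ≤ 1ℚ
0≤1 = ℚ.nonNegative⁻¹ 1ℚ

0<1 : 0ℚ < 1ℚ
0<1 = ℚ.positive⁻¹ 1ℚ

-- Defined by recursion so that `ι (suc n)` unfolds to `1ℚ + ι n`, the shape in which the ring
-- identities below receive it.
ι : ℕ → ℚ
ι zero    = 0ℚ
ι (suc n) = 1ℚ + ι n

ι-+ : ∀ m n → ι (m ℕ.+ n) ≡ ι m + ι n
ι-+ zero    n = sym (ℚ.+-identityˡ (ι n))
ι-+ (suc m) n = trans (cong (1ℚ +_) (ι-+ m n)) (sym (ℚ.+-assoc 1ℚ (ι m) (ι n)))

ι-* : ∀ m n → ι (m ℕ.* n) ≡ ι m * ι n
ι-* zero    n = sym (ℚ.*-zeroˡ (ι n))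
ι-* (suc m) n = trans (ι-+ n (m ℕ.* n)) (trans (cong (_+_ (ι n)) (ι-* m n)) (lemma (ι m) (ι n)))
  where
  lemma : ∀ x y → y + x * y ≡ (1ℚ + x) * y
  lemma = solve-∀ ℚ-ring

ι≥0 : ∀ n → 0ℚ ≤ ι n
ι≥0 zero    = ℚ.≤-refl
ι≥0 (suc n) = +-≥0 0≤1 (ι≥0 n)

ι-mono : ∀ {m n} → m ℕ.≤ n → ι m ≤ ι n
ι-mono {n = n} ℕ.z≤n   = ι≥0 n
ι-mono (ℕ.s≤s m≤n) = ℚ.+-monoʳ-≤ 1ℚ (ι-mono m≤n)

ι>0 : ∀ n → 0ℚ < ι (suc n)
ι>0 n = ℚ.<-≤-trans 0<1 (ι-mono {1} {suc n} (ℕ.s≤s ℕ.z≤n))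

ι-mono-< : ∀ {m n} → m ℕ.< n → ι m < ι n
ι-mono-< {m} m<n = ℚ.<-≤-trans
  (subst (_< ι (suc m)) (ℚ.+-identityˡ (ι m)) (ℚ.+-monoˡ-< (ι m) 0<1)) (ι-mono m<n)

ι-cancel : ∀ {m n} → ι m ≤ ι n → m ℕ.≤ n
ι-cancel {m} {n} ιm≤ιn with m ℕ.≤? n
... | yes m≤n = m≤n
... | no m≰n = contradiction (ℚ.<-≤-trans (ι-mono-< (ℕ.≰⇒> m≰n)) ιm≤ιn) (ℚ.<-irrefl refl)

toℚᵘ-ι : ∀ n → toℚᵘ (ι n) ℚᵘ.≃ ℚᵘ.mkℚᵘ (ℤ.+ n) 0
toℚᵘ-ι zero    = ℚᵘ.≃-refl
toℚᵘ-ι (suc n) = ℚᵘ.≃-trans (ℚ.toℚᵘ-homo-+ 1ℚ (ι n))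
  (ℚᵘ.≃-trans (ℚᵘ.+-congʳ ℚᵘ.1ℚᵘ (toℚᵘ-ι n))
    (ℚᵘ.*≡* (cong (λ a → (ℤ.1ℤ ℤ.+ a) ℤ.* ℤ.1ℤ) (ℤ.*-identityʳ (ℤ.+ n)))))

archimedean : ∀ x → ∃[ n ] x ≤ ι n
archimedean x@(mkℚ a d _) = ℤ.∣ a ∣ , ℚ.toℚᵘ-cancel-≤
  (ℚᵘ.≤-respʳ-≃ (ℚᵘ.≃-sym (toℚᵘ-ι ℤ.∣ a ∣)) (ℚᵘ.*≤* (bound a)))
  where
  bound : ∀ a → a ℤ.* ℤ.+ 1 ℤ.≤ ℤ.+ ℤ.∣ a ∣ ℤ.* ℤ.+ suc d
  bound (ℤ.+ n) = ℤ.*-monoˡ-≤-nonNeg (ℤ.+ n) (ℤ.+≤+ (ℕ.s≤s ℕ.z≤n))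
  bound -[1+ n ] = ℤ.-≤+

-- r n = 1/(n+1)

r : ℕ → ℚ
r n = 1/⁺ mkℕ⁺ (suc n)

ι-r : ∀ n → ι (suc n) * r n ≡ 1ℚ
ι-r n = ℚ.toℚᵘ-injective (ℚᵘ.≃-trans (ℚ.toℚᵘ-homo-* (ι (suc n)) (r n))
  (ℚᵘ.≃-trans (ℚᵘ.*-cong (toℚᵘ-ι (suc n)) (ℚ.toℚᵘ-fromℚᵘ (ℚᵘ.mkℚᵘ (ℤ.+ 1) n)))
    (ℚᵘ.*≡* (cong (λ k → ℤ.+ suc k) lemma))))
  where
  lemma : n ℕ.* 1 ℕ.* 1 ≡ n ℕ.+ 0 ℕ.+ 0
  lemma = ℕ-Solver.solve (n ∷ [])

r>0 : ∀ n → 0ℚ < r n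
r>0 n = ℚ.positive⁻¹ (r n) {{ℚ.normalize-pos 1 (suc n)}}

r≥0 : ∀ n → 0ℚ ≤ r n
r≥0 n = ℚ.<⇒≤ (r>0 n)

-- Reciprocals and their sums

-- R n k = 1/(n+1) + ⋯ + 1/(n+k)

R : ℕ → ℕ → ℚ
R n = sumOfReciprocals (mkℕ⁺ (suc n))

R-++ : ∀ n j k → R n (j ℕ.+ k) ≡ R n j + R (n ℕ.+ j) k
R-++ n zero    k = trans (cong (λ i → R i k) (sym (ℕ.+-identityʳ n)))
                         (sym (ℚ.+-identityˡ _))
R-++ n (suc j) k = trans (cong (_+_ (r n)) (trans (R-++ (suc n) j k)
    (cong (λ i → R (suc n) j + R i k) (sym (ℕ.+-suc n j)))))
  (sym (ℚ.+-assoc (r n) _ _))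

R≥0 : ∀ n k → 0ℚ ≤ R n k
R≥0 n zero    = ℚ.≤-refl
R≥0 n (suc k) = +-≥0 (r≥0 n) (R≥0 (suc n) k)

r-anti : ∀ {m n} → m ℕ.≤ n → r n ≤ r m
r-anti {m} {n} m≤n = subst₂ _≤_ left right
  (*-monoˡ (*-≥0 (r≥0 m) (r≥0 n)) (ι-mono (ℕ.s≤s m≤n)))
  where
  eq₁ : ∀ x a b → x * (a * b) ≡ (x * a) * b
  eq₁ = solve-∀ ℚ-ring
  eq₂ : ∀ x a b → x * (a * b) ≡ (x * b) * a
  eq₂ = solve-∀ ℚ-ring
  left : ι (suc m) * (r m * r n) ≡ r n
  left = trans (eq₁ (ι (suc m)) (r m) (r n)) (trans (cong (_* r n) (ι-r m)) (ℚ.*-identityˡ _))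
  right : ι (suc n) * (r m * r n) ≡ r m
  right = trans (eq₂ (ι (suc n)) (r m) (r n)) (trans (cong (_* r m) (ι-r n)) (ℚ.*-identityˡ _))

r≤1 : ∀ n → r n ≤ 1ℚ
r≤1 n = r-anti {0} {n} ℕ.z≤n

-- The exact convexity defect of the reciprocal: for centre c, 1/(c-d) + 1/(c+d) exceeds 2/c by
-- 2d²/(c(c²-d²)). Its sign gives the lower bound for a symmetric pair, its size the upper one.
r-pair : ∀ s d → let x = ι (suc s) ; y = ι d in
  r s + r (s ℕ.+ d ℕ.+ d) ≡
  ι 2 * r (s ℕ.+ d) + ι 2 * (y * y) * (r s * r (s ℕ.+ d) * r (s ℕ.+ d ℕ.+ d))
r-pair s d = begin
  a + e
    -- The units are placeholders for `x * a`, `(x + y) * b` and `(x + y + y) * e`; after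
    -- substitution only a polynomial identity is left.
    ≡⟨ p₁ a b e ⟩
  a * (1ℚ * 1ℚ) + e * (1ℚ * 1ℚ) - ι 2 * b * (1ℚ * 1ℚ) + ι 2 * b
    ≡⟨ cong₂ (λ u v → a * (u * v) + e * (1ℚ * u) - ι 2 * b * (1ℚ * v) + ι 2 * b) (sym be) (sym ee) ⟩
  a * (((x + y) * b) * ((x + y + y) * e)) + e * (1ℚ * ((x + y) * b)) - ι 2 * b * (1ℚ * ((x + y + y) * e)) + ι 2 * b
    ≡⟨ cong (λ u → a * (((x + y) * b) * ((x + y + y) * e)) + e * (u * ((x + y) * b))
                     - ι 2 * b * (u * ((x + y + y) * e)) + ι 2 * b) (sym ae) ⟩
  a * (((x + y) * b) * ((x + y + y) * e)) + e * ((x * a) * ((x + y) * b))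
    - ι 2 * b * ((x * a) * ((x + y + y) * e)) + ι 2 * b
    ≡⟨ p₂ x y a b e ⟩
  ι 2 * b + ι 2 * (y * y) * (a * b * e) ∎
  where
  open ≡-Reasoning
  x = ι (suc s)
  y = ι d
  a = r s
  b = r (s ℕ.+ d)
  e = r (s ℕ.+ d ℕ.+ d)
  ae : x * a ≡ 1ℚ
  ae = ι-r s
  be : (x + y) * b ≡ 1ℚ
  be = trans (cong (_* b) (sym (ι-+ (suc s) d))) (ι-r (s ℕ.+ d))
  ee : (x + y + y) * e ≡ 1ℚ
  ee = trans (cong (_* e) (sym (trans (ι-+ (suc s ℕ.+ d) d) (cong (_+ y) (ι-+ (suc s) d)))))
             (ι-r (s ℕ.+ d ℕ.+ d))
  p₁ : ∀ a b e → a + e ≡ a * (1ℚ * 1ℚ) + e * (1ℚ * 1ℚ) - ι 2 * b * (1ℚ * 1ℚ) + ι 2 * b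
  p₁ = solve-∀ ℚ-ring
  p₂ : ∀ x y a b e →
    a * (((x + y) * b) * ((x + y + y) * e)) + e * ((x * a) * ((x + y) * b))
      - ι 2 * b * ((x * a) * ((x + y + y) * e)) + ι 2 * b
    ≡ ι 2 * b + ι 2 * (y * y) * (a * b * e)
  p₂ = solve-∀ ℚ-ring

r-pair-lower : ∀ s d → ι 2 * r (s ℕ.+ d) ≤ r s + r (s ℕ.+ d ℕ.+ d)
r-pair-lower s d = ≤-from-+
  (*-≥0 (*-≥0 (ι≥0 2) (*-≥0 (ι≥0 d) (ι≥0 d)))
        (*-≥0 (*-≥0 (r≥0 s) (r≥0 (s ℕ.+ d))) (r≥0 (s ℕ.+ d ℕ.+ d))))
  (sym (r-pair s d))

-- The pair equals (2/c)(1 + d²/(c²-d²)); the hypothesis is d²/(c²-d²) ≤ β cleared of denominators.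
r-pair-upper : ∀ s d β → let c = ι (suc (s ℕ.+ d)) in
  ι d * ι d * (1ℚ + β) ≤ β * (c * c) →
  r s + r (s ℕ.+ d ℕ.+ d) ≤ ι 2 * r (s ℕ.+ d) * (1ℚ + β)
r-pair-upper s d β H = ≤-from-+
  (*-≥0 (*-≥0 (ι≥0 2) (*-≥0 (*-≥0 (r≥0 s) (r≥0 (s ℕ.+ d))) (r≥0 (s ℕ.+ d ℕ.+ d))))
        (0≤y-x H))
  (begin
  (a + e) + ι 2 * (a * b * e) * (β * (c * c) - y * y * (1ℚ + β))
    ≡⟨ cong₂ (λ p u → p + ι 2 * (a * b * e) * (β * (u * u) - y * y * (1ℚ + β))) (r-pair s d) (ι-+ (suc s) d) ⟩
  (ι 2 * b + ι 2 * (y * y) * (a * b * e)) + ι 2 * (a * b * e) * (β * ((x + y) * (x + y)) - y * y * (1ℚ + β))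
    ≡⟨ p₂ x y a b e β ⟩
  ι 2 * b * (1ℚ + β * ((x * a) * ((x + y + y) * e)))
    ≡⟨ cong₂ (λ u v → ι 2 * b * (1ℚ + β * (u * v))) (ι-r s) ee ⟩
  ι 2 * b * (1ℚ + β * (1ℚ * 1ℚ))
    ≡⟨⟩
  ι 2 * b * (1ℚ + β * 1ℚ)
    ≡⟨ cong (λ u → ι 2 * b * (1ℚ + u)) (ℚ.*-identityʳ β) ⟩
  ι 2 * b * (1ℚ + β) ∎)
  where
  open ≡-Reasoning
  x = ι (suc s)
  y = ι d
  c = ι (suc (s ℕ.+ d))
  a = r s
  b = r (s ℕ.+ d)
  e = r (s ℕ.+ d ℕ.+ d)
  ee : (x + y + y) * e ≡ 1ℚ
  ee = trans (cong (_* e) (sym (trans (ι-+ (suc s ℕ.+ d) d) (cong (_+ y) (ι-+ (suc s) d)))))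
             (ι-r (s ℕ.+ d ℕ.+ d))
  p₂ : ∀ x y a b e β →
    (ι 2 * b + ι 2 * (y * y) * (a * b * e)) + ι 2 * (a * b * e) * (β * ((x + y) * (x + y)) - y * y * (1ℚ + β))
    ≡ ι 2 * b * (1ℚ + β * ((x * a) * ((x + y + y) * e)))
  p₂ = solve-∀ ℚ-ring

-- Taking off both ends keeps the midpoint of the run, so inductions on odd runs compare symmetric
-- pairs with one fixed central term.
R-peel : ∀ s t → R s (suc (suc t ℕ.+ suc t)) ≡
  R (suc s) (suc (t ℕ.+ t)) + (r s + r (s ℕ.+ suc t ℕ.+ suc t))
R-peel s t = begin
  r s + R (suc s) (suc t ℕ.+ suc t)
    ≡⟨ cong (λ k → r s + R (suc s) k) (e₁ t) ⟩
  r s + R (suc s) (suc (t ℕ.+ t) ℕ.+ 1)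
    ≡⟨ cong (_+_ (r s)) (R-++ (suc s) (suc (t ℕ.+ t)) 1) ⟩
  r s + (R (suc s) (suc (t ℕ.+ t)) + (r (suc s ℕ.+ suc (t ℕ.+ t)) + 0ℚ))
    ≡⟨ cong (λ i → r s + (R (suc s) (suc (t ℕ.+ t)) + (r i + 0ℚ))) (e₂ s t) ⟩
  r s + (R (suc s) (suc (t ℕ.+ t)) + (r (s ℕ.+ suc t ℕ.+ suc t) + 0ℚ))
    ≡⟨ e₃ (r s) (R (suc s) (suc (t ℕ.+ t))) (r (s ℕ.+ suc t ℕ.+ suc t)) ⟩
  R (suc s) (suc (t ℕ.+ t)) + (r s + r (s ℕ.+ suc t ℕ.+ suc t)) ∎
  where
  open ≡-Reasoning
  e₁ : ∀ t → suc t ℕ.+ suc t ≡ suc (t ℕ.+ t) ℕ.+ 1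
  e₁ = ℕ-Solver.solve-∀
  e₂ : ∀ s t → suc s ℕ.+ suc (t ℕ.+ t) ≡ s ℕ.+ suc t ℕ.+ suc t
  e₂ = ℕ-Solver.solve-∀
  e₃ : ∀ a b c → a + (b + (c + 0ℚ)) ≡ b + (a + c)
  e₃ = solve-∀ ℚ-ring

ι-odd : ∀ t → ι (suc (suc t ℕ.+ suc t)) ≡ ι (suc (t ℕ.+ t)) + ι 2
ι-odd t = trans (cong ι (e t)) (ι-+ (suc (t ℕ.+ t)) 2)
  where
  e : ∀ t → suc (suc t ℕ.+ suc t) ≡ suc (t ℕ.+ t) ℕ.+ 2
  e = ℕ-Solver.solve-∀

R-odd-lower : ∀ t s → ι (suc (t ℕ.+ t)) * r (s ℕ.+ t) ≤ R s (suc (t ℕ.+ t))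
R-odd-lower zero s = ℚ.≤-reflexive
  (trans (cong (λ i → ι 1 * r i) (ℕ.+-identityʳ s)) (e (r s)))
  where
  e : ∀ a → ι 1 * a ≡ a + 0ℚ
  e = solve-∀ ℚ-ring
R-odd-lower (suc t) s = begin
  ι (suc (suc t ℕ.+ suc t)) * b          ≡⟨ cong (_* b) (ι-odd t) ⟩
  (ι (suc (t ℕ.+ t)) + ι 2) * b          ≡⟨ ℚ.*-distribʳ-+ b (ι (suc (t ℕ.+ t))) (ι 2) ⟩
  ι (suc (t ℕ.+ t)) * b + ι 2 * b        ≡⟨ cong (λ i → ι (suc (t ℕ.+ t)) * r i + ι 2 * b) (ℕ.+-suc s t) ⟩
  ι (suc (t ℕ.+ t)) * r (suc s ℕ.+ t) + ι 2 * b
    ≤⟨ ℚ.+-mono-≤ (R-odd-lower t (suc s)) (r-pair-lower s (suc t)) ⟩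
  R (suc s) (suc (t ℕ.+ t)) + (r s + r (s ℕ.+ suc t ℕ.+ suc t)) ≡⟨ R-peel s t ⟨
  R s (suc (suc t ℕ.+ suc t)) ∎
  where
  open ℚ.≤-Reasoning
  b = r (s ℕ.+ suc t)

R-odd-upper : ∀ t s β → 0ℚ ≤ β → let c = ι (suc (s ℕ.+ t)) in
  ι t * ι t * (1ℚ + β) ≤ β * (c * c) →
  R s (suc (t ℕ.+ t)) ≤ ι (suc (t ℕ.+ t)) * r (s ℕ.+ t) * (1ℚ + β)
R-odd-upper zero s β 0≤β H = ≤-from-+ (*-≥0 (r≥0 s) 0≤β)
  (trans (e (r s) β) (cong (λ i → ι 1 * r i * (1ℚ + β)) (sym (ℕ.+-identityʳ s))))
  where
  e : ∀ a β → a + 0ℚ + a * β ≡ ι 1 * a * (1ℚ + β)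
  e = solve-∀ ℚ-ring
R-odd-upper (suc t) s β 0≤β H = begin
  R s (suc (suc t ℕ.+ suc t))            ≡⟨ R-peel s t ⟩
  R (suc s) (suc (t ℕ.+ t)) + (r s + r (s ℕ.+ suc t ℕ.+ suc t))
    ≤⟨ ℚ.+-mono-≤ (R-odd-upper t (suc s) β 0≤β H′) (r-pair-upper s (suc t) β H) ⟩
  ι (suc (t ℕ.+ t)) * r (suc s ℕ.+ t) * (1ℚ + β) + ι 2 * b * (1ℚ + β)
    ≡⟨ cong (λ i → ι (suc (t ℕ.+ t)) * r i * (1ℚ + β) + ι 2 * b * (1ℚ + β)) (ℕ.+-suc s t) ⟨
  ι (suc (t ℕ.+ t)) * b * (1ℚ + β) + ι 2 * b * (1ℚ + β) ≡⟨ e (ι (suc (t ℕ.+ t))) b β ⟩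
  (ι (suc (t ℕ.+ t)) + ι 2) * b * (1ℚ + β)              ≡⟨ cong (λ u → u * b * (1ℚ + β)) (ι-odd t) ⟨
  ι (suc (suc t ℕ.+ suc t)) * b * (1ℚ + β)              ∎
  where
  open ℚ.≤-Reasoning
  b = r (s ℕ.+ suc t)
  e : ∀ o b β → o * b * (1ℚ + β) + ι 2 * b * (1ℚ + β) ≡ (o + ι 2) * b * (1ℚ + β)
  e = solve-∀ ℚ-ring
  t≤ : ι t ≤ ι (suc t)
  t≤ = ι-mono (ℕ.n≤1+n t)
  -- Inner pairs lie closer to the common centre, so a β that suits the outermost pair suits them
  -- all.
  H′ : ι t * ι t * (1ℚ + β) ≤ β * (ι (suc (suc s ℕ.+ t)) * ι (suc (suc s ℕ.+ t)))
  H′ = subst (λ i → ι t * ι t * (1ℚ + β) ≤ β * (ι (suc i) * ι (suc i))) (ℕ.+-suc s t)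
    (ℚ.≤-trans (*-monoˡ (+-≥0 0≤1 0≤β) (*-mono (ι≥0 t) t≤ (ι≥0 t) t≤)) H)

-- Refinement of a sum of reciprocals by an odd factor

module _ (s : ℕ) where
  private
    t = suc (s ℕ.+ s)

  -- The t = 2s+1 integers that refine n+1 are centred at (n+1)t, and t copies of the central
  -- reciprocal make exactly 1/(n+1).
  r-scaled : ∀ n → ι t * r (n ℕ.* t ℕ.+ s ℕ.+ s) ≡ r n
  r-scaled n = begin
    ι t * b                         ≡⟨ e₁ (ι t) b ⟩
    ι t * b * 1ℚ                    ≡⟨ cong (_*_ (ι t * b)) (ι-r n) ⟨
    ι t * b * (ι (suc n) * r n)     ≡⟨ e₂ (ι t) b (ι (suc n)) (r n) ⟩
    ι (suc n) * ι t * b * r n       ≡⟨ cong (λ u → u * b * r n) (ι-* (suc n) t) ⟨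
    ι (suc n ℕ.* t) * b * r n       ≡⟨ cong (λ i → ι i * b * r n) (e₃ n s) ⟩
    ι (suc (n ℕ.* t ℕ.+ s ℕ.+ s)) * b * r n ≡⟨ cong (_* r n) (ι-r (n ℕ.* t ℕ.+ s ℕ.+ s)) ⟩
    1ℚ * r n                        ≡⟨ ℚ.*-identityˡ (r n) ⟩
    r n                             ∎
    where
    open ≡-Reasoning
    b = r (n ℕ.* t ℕ.+ s ℕ.+ s)
    e₁ : ∀ t b → t * b ≡ t * b * 1ℚ
    e₁ = solve-∀ ℚ-ring
    e₂ : ∀ t b l ρ → t * b * (l * ρ) ≡ l * t * b * ρ
    e₂ = solve-∀ ℚ-ring
    e₃ : ∀ n s → suc n ℕ.* suc (s ℕ.+ s) ≡ suc (n ℕ.* suc (s ℕ.+ s) ℕ.+ s ℕ.+ s)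
    e₃ = ℕ-Solver.solve-∀

  cell-lower : ∀ n → r n ≤ R (n ℕ.* t ℕ.+ s) t
  cell-lower n = subst (_≤ R (n ℕ.* t ℕ.+ s) t) (r-scaled n) (R-odd-lower s (n ℕ.* t ℕ.+ s))

  cell-upper : ∀ n → R (n ℕ.* t ℕ.+ s) t ≤ r n * (1ℚ + r n * r n)
  cell-upper n = subst (λ u → R (n ℕ.* t ℕ.+ s) t ≤ u * (1ℚ + β)) (r-scaled n)
    (R-odd-upper s (n ℕ.* t ℕ.+ s) β 0≤β H)
    where
    ρ = r n
    β = ρ * ρ
    0≤β : 0ℚ ≤ β
    0≤β = *-≥0 (r≥0 n) (r≥0 n)
    β≤1 : β ≤ 1ℚ
    β≤1 = *-mono (r≥0 n) (r≤1 n) (r≥0 n) (r≤1 n)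
    c = ι (suc (n ℕ.* t ℕ.+ s ℕ.+ s))
    ρc : ρ * c ≡ 1ℚ + (ι s + ι s)
    ρc = begin
      ρ * c                   ≡⟨ cong (λ i → ρ * ι i) (e₃ n s) ⟨
      ρ * ι (suc n ℕ.* t)     ≡⟨ cong (_*_ ρ) (ι-* (suc n) t) ⟩
      ρ * (ι (suc n) * ι t)   ≡⟨ e₄ ρ (ι (suc n)) (ι t) ⟩
      ι (suc n) * ρ * ι t     ≡⟨ cong (_* ι t) (ι-r n) ⟩
      1ℚ * ι t                ≡⟨ ℚ.*-identityˡ (ι t) ⟩
      ι t                     ≡⟨ cong (_+_ 1ℚ) (ι-+ s s) ⟩
      1ℚ + (ι s + ι s)        ∎
      where
      open ≡-Reasoning
      e₃ : ∀ n s → suc n ℕ.* suc (s ℕ.+ s) ≡ suc (n ℕ.* suc (s ℕ.+ s) ℕ.+ s ℕ.+ s)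
      e₃ = ℕ-Solver.solve-∀
      e₄ : ∀ a b c → a * (b * c) ≡ b * a * c
      e₄ = solve-∀ ℚ-ring
    -- Here c = (n+1)(2s+1), so the right side is (2s+1)², while the left is at most 2s² because β ≤
    -- 1.
    H : ι s * ι s * (1ℚ + β) ≤ β * (c * c)
    H = ≤-from-+
      (+-≥0 (*-≥0 (*-≥0 (ι≥0 s) (ι≥0 s)) (0≤y-x β≤1))
            (+-≥0 (+-≥0 0≤1 (*-≥0 (ι≥0 4) (ι≥0 s))) (*-≥0 (ι≥0 2) (*-≥0 (ι≥0 s) (ι≥0 s)))))
      (begin
      ι s * ι s * (1ℚ + β) + (ι s * ι s * (1ℚ - β) + ((1ℚ + ι 4 * ι s) + ι 2 * (ι s * ι s)))
        ≡⟨ e₅ (ι s) β ⟩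
      (1ℚ + (ι s + ι s)) * (1ℚ + (ι s + ι s))
        ≡⟨ cong (λ u → u * u) ρc ⟨
      (ρ * c) * (ρ * c)
        ≡⟨ e₆ ρ c ⟩
      β * (c * c) ∎)
      where
      open ≡-Reasoning
      e₅ : ∀ s β → s * s * (1ℚ + β) + (s * s * (1ℚ - β) + ((1ℚ + ι 4 * s) + ι 2 * (s * s)))
           ≡ (1ℚ + (s + s)) * (1ℚ + (s + s))
      e₅ = solve-∀ ℚ-ring
      e₆ : ∀ ρ c → (ρ * c) * (ρ * c) ≡ ρ * ρ * (c * c)
      e₆ = solve-∀ ℚ-ring

  R-split : ∀ n k → R (n ℕ.* t ℕ.+ s) (suc k ℕ.* t) ≡
    R (n ℕ.* t ℕ.+ s) t + R (suc n ℕ.* t ℕ.+ s) (k ℕ.* t)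
  R-split n k = trans (R-++ (n ℕ.* t ℕ.+ s) t (k ℕ.* t))
    (cong (λ i → R (n ℕ.* t ℕ.+ s) t + R i (k ℕ.* t)) (e n s t))
    where
    e : ∀ n s t → n ℕ.* t ℕ.+ s ℕ.+ t ≡ t ℕ.+ n ℕ.* t ℕ.+ s
    e = ℕ-Solver.solve-∀

  refine-lower : ∀ k n → R n k ≤ R (n ℕ.* t ℕ.+ s) (k ℕ.* t)
  refine-lower zero    n = ℚ.≤-refl
  refine-lower (suc k) n = subst (R n (suc k) ≤_) (sym (R-split n k))
    (ℚ.+-mono-≤ (cell-lower n) (refine-lower k (suc n)))

  -- Each refined cell gains at most the cube of its reciprocal. The bound `b` dominates the first,
  -- hence the largest, reciprocal and stays fixed in the induction.
  refine-upper : ∀ k n b → r n ≤ b →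
    R (n ℕ.* t ℕ.+ s) (k ℕ.* t) ≤ R n k + ι k * (b * (b * b))
  refine-upper zero    n b H = ℚ.≤-reflexive (e (b * (b * b)))
    where
    e : ∀ c → 0ℚ ≡ 0ℚ + 0ℚ * c
    e = solve-∀ ℚ-ring
  refine-upper (suc k) n b H = begin
    R (n ℕ.* t ℕ.+ s) (suc k ℕ.* t)
      ≡⟨ R-split n k ⟩
    R (n ℕ.* t ℕ.+ s) t + R (suc n ℕ.* t ℕ.+ s) (k ℕ.* t)
      ≤⟨ ℚ.+-mono-≤ (cell-upper n)
           (refine-upper k (suc n) b (ℚ.≤-trans (r-anti (ℕ.n≤1+n n)) H)) ⟩
    r n * (1ℚ + r n * r n) + (R (suc n) k + ι k * (b * (b * b)))
      ≡⟨ e₁ (r n) _ _ ⟩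
    r n * (r n * r n) + (r n + R (suc n) k + ι k * (b * (b * b)))
      ≤⟨ ℚ.+-monoˡ-≤ _ (*-mono (r≥0 n) H (*-≥0 (r≥0 n) (r≥0 n)) (*-mono (r≥0 n) H (r≥0 n) H)) ⟩
    b * (b * b) + (r n + R (suc n) k + ι k * (b * (b * b)))
      ≡⟨ e₂ (b * (b * b)) (R n (suc k)) (ι k) ⟩
    R n (suc k) + ι (suc k) * (b * (b * b)) ∎
    where
    open ℚ.≤-Reasoning
    e₁ : ∀ ρ x y → ρ * (1ℚ + ρ * ρ) + (x + y) ≡ ρ * (ρ * ρ) + (ρ + x + y)
    e₁ = solve-∀ ℚ-ring
    e₂ : ∀ c x k → c + (x + k * c) ≡ x + (1ℚ + k) * c
    e₂ = solve-∀ ℚ-ring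

-- Truncations of the exponential series

expTerm : ℕ → ℚ → ℚ
expTerm zero    x = 1ℚ
expTerm (suc j) x = expTerm j x * x * r j

E : ℕ → ℚ → ℚ
E zero    x = 0ℚ
E (suc J) x = E J x + expTerm J x

expTerm-suc : ∀ j x → ι (suc j) * expTerm (suc j) x ≡ expTerm j x * x
expTerm-suc j x = trans (e (ι (suc j)) (expTerm j x * x) (r j))
  (trans (cong (_* (expTerm j x * x)) (ι-r j)) (ℚ.*-identityˡ (expTerm j x * x)))
  where
  e : ∀ n y r → n * (y * r) ≡ n * r * y
  e = solve-∀ ℚ-ring

expTerm≥0 : ∀ j {x} → 0ℚ ≤ x → 0ℚ ≤ expTerm j x
expTerm≥0 zero    0≤x = 0≤1
expTerm≥0 (suc j) 0≤x = *-≥0 (*-≥0 (expTerm≥0 j 0≤x) 0≤x) (r≥0 j)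

expTerm-mono : ∀ j {x y} → 0ℚ ≤ x → x ≤ y → expTerm j x ≤ expTerm j y
expTerm-mono zero    0≤x x≤y = ℚ.≤-refl
expTerm-mono (suc j) 0≤x x≤y = *-monoˡ (r≥0 j)
  (*-mono (expTerm≥0 j 0≤x) (expTerm-mono j 0≤x x≤y) 0≤x x≤y)

E-mono : ∀ J {x y} → 0ℚ ≤ x → x ≤ y → E J x ≤ E J y
E-mono zero    0≤x x≤y = ℚ.≤-refl
E-mono (suc J) 0≤x x≤y = ℚ.+-mono-≤ (E-mono J 0≤x x≤y) (expTerm-mono J 0≤x x≤y)

E-≤-suc : ∀ J {x} → 0ℚ ≤ x → E J x ≤ E (suc J) x
E-≤-suc J 0≤x = ≤-from-+ (expTerm≥0 J 0≤x) refl

E-mono-index : ∀ k J {x} → 0ℚ ≤ x → E J x ≤ E (k ℕ.+ J) x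
E-mono-index zero    J 0≤x = ℚ.≤-refl
E-mono-index (suc k) J 0≤x = ℚ.≤-trans (E-mono-index k J 0≤x) (E-≤-suc (k ℕ.+ J) 0≤x)

E-at-0 : ∀ J → E (suc J) 0ℚ ≡ 1ℚ
E-at-0 zero    = refl
E-at-0 (suc J) = cong₂ _+_ (E-at-0 J) (e (expTerm J 0ℚ) (r J))
  where
  e : ∀ y r → y * 0ℚ * r ≡ 0ℚ
  e = solve-∀ ℚ-ring

-- Convexity on x ≥ 0: `expTerm j` is the derivative of `expTerm (suc j)`, so the left side is a
-- tangent line. The induction multiplies by x + h and drops the h² term.
expTerm-tangent : ∀ j x h → 0ℚ ≤ x → 0ℚ ≤ h →
  expTerm (suc j) x + h * expTerm j x ≤ expTerm (suc j) (x + h)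
expTerm-tangent zero x h 0≤x 0≤h = ℚ.≤-reflexive (e x h)
  where
  e : ∀ x h → 1ℚ * x * 1ℚ + h * 1ℚ ≡ 1ℚ * (x + h) * 1ℚ
  e = solve-∀ ℚ-ring
expTerm-tangent (suc j) x h 0≤x 0≤h = *-cancelʳ (ι>0 (suc j)) (begin
  (t″ + h * t′) * (1ℚ + n)
    ≡⟨ e₁ t″ t′ h n ⟩
  (1ℚ + n) * t″ + h * t′ + h * (n * t′)
    ≡⟨ cong₂ (λ u v → u + h * t′ + h * v) (expTerm-suc (suc j) x) (expTerm-suc j x) ⟩
  t′ * x + h * t′ + h * (t * x)
    ≤⟨ ≤-from-+ (*-≥0 (*-≥0 0≤h 0≤h) (expTerm≥0 j 0≤x)) (e₂ t t′ h x) ⟩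
  (t′ + h * t) * (x + h)
    ≤⟨ *-monoˡ (+-≥0 0≤x 0≤h) (expTerm-tangent j x h 0≤x 0≤h) ⟩
  expTerm (suc j) (x + h) * (x + h)
    ≡⟨ expTerm-suc (suc j) (x + h) ⟨
  (1ℚ + n) * expTerm (suc (suc j)) (x + h)
    ≡⟨ ℚ.*-comm (1ℚ + n) (expTerm (suc (suc j)) (x + h)) ⟩
  expTerm (suc (suc j)) (x + h) * (1ℚ + n) ∎)
  where
  open ℚ.≤-Reasoning
  n = ι (suc j)
  t = expTerm j x
  t′ = expTerm (suc j) x
  t″ = expTerm (suc (suc j)) x
  e₁ : ∀ t″ t′ h n → (t″ + h * t′) * (1ℚ + n) ≡ (1ℚ + n) * t″ + h * t′ + h * (n * t′)
  e₁ = solve-∀ ℚ-ring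
  e₂ : ∀ t t′ h x → (t′ * x + h * t′ + h * (t * x)) + h * h * t ≡ (t′ + h * t) * (x + h)
  e₂ = solve-∀ ℚ-ring

E-tangent : ∀ J x h → 0ℚ ≤ x → 0ℚ ≤ h → E (suc J) x + h * E J x ≤ E (suc J) (x + h)
E-tangent zero x h 0≤x 0≤h = ℚ.≤-reflexive (e h)
  where
  e : ∀ h → 0ℚ + 1ℚ + h * 0ℚ ≡ 0ℚ + 1ℚ
  e = solve-∀ ℚ-ring
E-tangent (suc J) x h 0≤x 0≤h = subst (_≤ E (suc (suc J)) (x + h))
  (e (E (suc J) x) (E J x) (expTerm (suc J) x) (expTerm J x) h)
  (ℚ.+-mono-≤ (E-tangent J x h 0≤x 0≤h) (expTerm-tangent J x h 0≤x 0≤h))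
  where
  e : ∀ E′ E t′ t h → E′ + h * E + (t′ + h * t) ≡ E′ + t′ + h * (E + t)
  e = solve-∀ ℚ-ring

-- Exponentiated form of log((n+1+k)/(n+1)) ≤ `R n k`: each summand h gives a factor 1 + h ≤ exp h,
-- and these factors telescope. For truncations (1 + h) `E J a` is bounded by `E (suc J) (a + h)`,
-- so every summand costs one more term of the series.
E-lower : ∀ k n J a → 0ℚ ≤ a →
  ι (suc n ℕ.+ k) * E J a ≤ ι (suc n) * E (k ℕ.+ J) (a + R n k)
E-lower zero n J a 0≤a = ℚ.≤-reflexive (cong₂ (λ i x → ι i * E J x)
  (ℕ.+-identityʳ (suc n)) (sym (ℚ.+-identityʳ a)))
E-lower (suc k) n J a 0≤a = *-cancelʳ (ι>0 (suc n)) (begin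
  ι (suc n ℕ.+ suc k) * E J a * (1ℚ + l)
    ≡⟨ cong (λ i → ι i * E J a * (1ℚ + l)) (ℕ.+-suc (suc n) k) ⟩
  K * E J a * (1ℚ + l)
    ≡⟨ cong (λ u → K * E J a * (u + l)) (ι-r n) ⟨
  K * E J a * (l * h + l)
    ≡⟨ e₁ K (E J a) l h ⟩
  K * l * (E J a + h * E J a)
    ≤⟨ *-monoʳ (*-≥0 (ι≥0 (suc (suc n) ℕ.+ k)) (ι≥0 (suc n)))
         (ℚ.≤-trans (ℚ.+-monoˡ-≤ (h * E J a) (E-≤-suc J 0≤a)) (E-tangent J a h 0≤a (r≥0 n))) ⟩
  K * l * E (suc J) (a + h)
    ≡⟨ e₂ K l (E (suc J) (a + h)) ⟩
  l * (K * E (suc J) (a + h))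
    ≤⟨ *-monoʳ (ι≥0 (suc n)) (E-lower k (suc n) (suc J) (a + h) (+-≥0 0≤a (r≥0 n))) ⟩
  l * ((1ℚ + l) * E (k ℕ.+ suc J) (a + h + R (suc n) k))
    ≡⟨ cong₂ (λ i x → l * ((1ℚ + l) * E i x)) (ℕ.+-suc k J) (ℚ.+-assoc a h (R (suc n) k)) ⟩
  l * ((1ℚ + l) * E (suc k ℕ.+ J) (a + R n (suc k)))
    ≡⟨ e₃ l (1ℚ + l) (E (suc k ℕ.+ J) (a + R n (suc k))) ⟩
  l * E (suc k ℕ.+ J) (a + R n (suc k)) * (1ℚ + l) ∎)
  where
  open ℚ.≤-Reasoning
  l = ι (suc n)
  h = r n
  K = ι (suc (suc n) ℕ.+ k)
  e₁ : ∀ K E l h → K * E * (l * h + l) ≡ K * l * (E + h * E)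
  e₁ = solve-∀ ℚ-ring
  e₂ : ∀ K l E → K * l * E ≡ l * (K * E)
  e₂ = solve-∀ ℚ-ring
  e₃ : ∀ l m E → l * (m * E) ≡ l * E * m
  e₃ = solve-∀ ℚ-ring

-- The trapezoidal rule for the truncated exponential

module _ (a h : ℚ) (0≤a : 0ℚ ≤ a) (0≤h : 0ℚ ≤ h) where
  private
    b = a + h
    0≤b : 0ℚ ≤ b
    0≤b = +-≥0 0≤a 0≤h
    a≤b : a ≤ b
    a≤b = ≤-from-+ 0≤h refl

  -- Twice the error of the trapezoidal rule for the derivative of expTerm (suc j).
  trapezoidError : ℕ → ℚ
  trapezoidError j =
    h * (expTerm j a + expTerm j b) - ι 2 * (expTerm (suc j) b - expTerm (suc j) a)

  -- Makes nonnegativity of the error an induction: with 0 ≤ a ≤ b both terms on the right are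
  -- nonnegative.
  trapezoidError-suc : ∀ j → trapezoidError (suc j) * (ι 2 * ι (suc (suc j))) ≡
    (a + b) * trapezoidError j + h * h * (expTerm j b - expTerm j a)
  trapezoidError-suc j = begin
    (h * (a′ + b′) - ι 2 * (b″ - a″)) * (ι 2 * (1ℚ + n))
      ≡⟨ e₁ h a′ b′ a″ b″ n ⟩
    ι 2 * h * (a′ + b′) + ι 2 * h * (n * a′ + n * b′) - ι 4 * ((1ℚ + n) * b″ - (1ℚ + n) * a″)
      ≡⟨ cong₂ (λ u v → ι 2 * h * (a′ + b′) + ι 2 * h * (u + v) - ι 4 * ((1ℚ + n) * b″ - (1ℚ + n) * a″))
           (expTerm-suc j a) (expTerm-suc j b) ⟩
    ι 2 * h * (a′ + b′) + ι 2 * h * (a₀ * a + b₀ * b) - ι 4 * ((1ℚ + n) * b″ - (1ℚ + n) * a″)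
      ≡⟨ cong₂ (λ u v → ι 2 * h * (a′ + b′) + ι 2 * h * (a₀ * a + b₀ * b) - ι 4 * (v - u))
           (expTerm-suc (suc j) a) (expTerm-suc (suc j) b) ⟩
    ι 2 * h * (a′ + b′) + ι 2 * h * (a₀ * a + b₀ * b) - ι 4 * (b′ * b - a′ * a)
      ≡⟨ e₂ a h a₀ b₀ a′ b′ ⟩
    (a + b) * (h * (a₀ + b₀) - ι 2 * (b′ - a′)) + h * h * (b₀ - a₀) ∎
    where
    open ≡-Reasoning
    n = ι (suc j)
    a₀ = expTerm j a
    b₀ = expTerm j b
    a′ = expTerm (suc j) a
    b′ = expTerm (suc j) b
    a″ = expTerm (suc (suc j)) a
    b″ = expTerm (suc (suc j)) b
    e₁ : ∀ h a′ b′ a″ b″ n → (h * (a′ + b′) - ι 2 * (b″ - a″)) * (ι 2 * (1ℚ + n)) ≡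
      ι 2 * h * (a′ + b′) + ι 2 * h * (n * a′ + n * b′) - ι 4 * ((1ℚ + n) * b″ - (1ℚ + n) * a″)
    e₁ = solve-∀ ℚ-ring
    e₂ : ∀ a h a₀ b₀ a′ b′ →
      ι 2 * h * (a′ + b′) + ι 2 * h * (a₀ * a + b₀ * (a + h)) - ι 4 * (b′ * (a + h) - a′ * a) ≡
      (a + (a + h)) * (h * (a₀ + b₀) - ι 2 * (b′ - a′)) + h * h * (b₀ - a₀)
    e₂ = solve-∀ ℚ-ring

  trapezoidError≥0 : ∀ j → 0ℚ ≤ trapezoidError j
  trapezoidError≥0 zero = ℚ.≤-reflexive (e a h)
    where
    e : ∀ a h → 0ℚ ≡ h * (1ℚ + 1ℚ) - ι 2 * (1ℚ * (a + h) * 1ℚ - 1ℚ * a * 1ℚ)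
    e = solve-∀ ℚ-ring
  trapezoidError≥0 (suc j) = *-cancelʳ (*->0 (ι>0 1) (ι>0 (suc j)))
    (subst₂ _≤_ (sym (ℚ.*-zeroˡ (ι 2 * ι (suc (suc j))))) (sym (trapezoidError-suc j))
      (+-≥0 (*-≥0 (+-≥0 0≤a 0≤b) (trapezoidError≥0 j))
            (*-≥0 (*-≥0 0≤h 0≤h) (0≤y-x (expTerm-mono j 0≤a a≤b)))))

  -- At j = 1 the last term of the recurrence is h²(b - a) = h³. It is the classical error h³ f″/12
  -- for f = x²/2, doubled and multiplied by 6.
  h³≤6trapezoidError₂ : h * h * h ≤ ι 6 * trapezoidError 2
  h³≤6trapezoidError₂ = ≤-from-+ (*-≥0 (+-≥0 0≤a 0≤b) (trapezoidError≥0 1)) (begin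
    h * h * h + (a + b) * trapezoidError 1
      ≡⟨ e₁ a h (trapezoidError 1) ⟩
    (a + b) * trapezoidError 1 + h * h * (1ℚ * b * 1ℚ - 1ℚ * a * 1ℚ)
      ≡⟨ trapezoidError-suc 1 ⟨
    trapezoidError 2 * (ι 2 * ι 3)
      ≡⟨ ℚ.*-comm (trapezoidError 2) (ι 6) ⟩
    ι 6 * trapezoidError 2 ∎)
    where
    open ≡-Reasoning
    e₁ : ∀ a h t → h * h * h + (a + (a + h)) * t ≡
      (a + (a + h)) * t + h * h * (1ℚ * (a + h) * 1ℚ - 1ℚ * a * 1ℚ)
    e₁ = solve-∀ ℚ-ring

  -- The h³ here is what puts the sum S(K) below 1: it survives as the deficit 1/N².
  E-trapezoid : ∀ J → h * h * h + ι 12 * (E (4 ℕ.+ J) b - E (4 ℕ.+ J) a) ≤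
    ι 6 * (h * (E (3 ℕ.+ J) a + E (3 ℕ.+ J) b))
  -- Four terms form the first truncation that contains the cubic term, the source of h³.
  E-trapezoid zero = ≤-from-+
    (+-≥0 (0≤y-x h³≤6trapezoidError₂)
          (*-≥0 (ι≥0 6) (+-≥0 (trapezoidError≥0 0) (trapezoidError≥0 1))))
    (e h (expTerm 1 a) (expTerm 2 a) (expTerm 3 a) (expTerm 1 b) (expTerm 2 b) (expTerm 3 b))
    where
    e : ∀ h a₁ a₂ a₃ b₁ b₂ b₃ →
      h * h * h + ι 12 * ((0ℚ + 1ℚ + b₁ + b₂ + b₃) - (0ℚ + 1ℚ + a₁ + a₂ + a₃)) +
      ((ι 6 * (h * (a₂ + b₂) - ι 2 * (b₃ - a₃)) - h * h * h) +
       ι 6 * ((h * (1ℚ + 1ℚ) - ι 2 * (b₁ - a₁)) + (h * (a₁ + b₁) - ι 2 * (b₂ - a₂))))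
      ≡ ι 6 * (h * ((0ℚ + 1ℚ + a₁ + a₂) + (0ℚ + 1ℚ + b₁ + b₂)))
    e = solve-∀ ℚ-ring
  E-trapezoid (suc J) = subst₂ _≤_
    (e₁ h (E (4 ℕ.+ J) a) (E (4 ℕ.+ J) b) (expTerm (4 ℕ.+ J) a) (expTerm (4 ℕ.+ J) b))
    (e₂ h (E (3 ℕ.+ J) a) (E (3 ℕ.+ J) b) (expTerm (3 ℕ.+ J) a) (expTerm (3 ℕ.+ J) b)
        (expTerm (4 ℕ.+ J) a) (expTerm (4 ℕ.+ J) b))
    (ℚ.+-monoˡ-≤ _ (ℚ.≤-trans (E-trapezoid J)
      (≤-from-+ (*-≥0 (ι≥0 6) (trapezoidError≥0 (3 ℕ.+ J))) refl)))
    where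
    e₁ : ∀ h A B a b → h * h * h + ι 12 * (B - A) + ι 12 * (b - a) ≡
      h * h * h + ι 12 * ((B + b) - (A + a))
    e₁ = solve-∀ ℚ-ring
    e₂ : ∀ h A B a b a′ b′ →
      ι 6 * (h * (A + B)) + ι 6 * (h * (a + b) - ι 2 * (b′ - a′)) + ι 12 * (b′ - a′)
      ≡ ι 6 * (h * ((A + a) + (B + b)))
    e₂ = solve-∀ ℚ-ring

module _ (n : ℕ) where
  private
    l = ι (suc n)
    h = r n
    y = r (n ℕ.+ n)
    y′ = r (suc n ℕ.+ suc n)

    l≡ : (l + l - 1ℚ) * y ≡ 1ℚ
    l≡ = trans (cong (_* y) (trans (e₁ (ι n)) (cong (_+_ 1ℚ) (sym (ι-+ n n))))) (ι-r (n ℕ.+ n))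
      where
      e₁ : ∀ x → (1ℚ + x) + (1ℚ + x) - 1ℚ ≡ 1ℚ + (x + x)
      e₁ = solve-∀ ℚ-ring
    l≡′ : (l + l + 1ℚ) * y′ ≡ 1ℚ
    l≡′ = trans (cong (_* y′) (trans (e₁ (ι n)) (cong (_+_ 1ℚ) (sym (ι-+ (suc n) (suc n))))))
                (ι-r (suc n ℕ.+ suc n))
      where
      e₁ : ∀ x → (1ℚ + x) + (1ℚ + x) + 1ℚ ≡ 1ℚ + ((1ℚ + x) + (1ℚ + x))
      e₁ = solve-∀ ℚ-ring

  -- The trapezoidal bound rearranges to (1 - h/2) E(a+h) ≤ (1 + h/2) E(a) - h³/12. Multiplying by
  -- 2l, where l h = 1, produces the factors 2l-1 and 2l+1, twice the ends of the unit cell around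
  -- l, and the surplus h²/6.
  E-upper-step : ∀ J a → 0ℚ ≤ a →
    ι 24 * (E (4 ℕ.+ J) (a + h) * y′) + (h * h) * (ι 2 * y * (ι 2 * y′)) ≤
    ι 24 * (E (4 ℕ.+ J) a * y)
  E-upper-step J a 0≤a = ≤-from-+
    (*-≥0 (*-≥0 (ι≥0 4) (*-≥0 (r≥0 (n ℕ.+ n)) (r≥0 (suc n ℕ.+ suc n)))) (*-≥0 (ι≥0 (suc n)) (0≤y-x key)))
    (begin
    (ι 24 * (B * y′) + (h * h) * (ι 2 * y * (ι 2 * y′))) +
      ι 4 * (y * y′) * (l * (ι 6 * (h * (A + B)) - (h * h * h + ι 12 * (B - A))))
      ≡⟨ e₁ A B l h y y′ ⟩
    ι 24 * (B * y′) + ι 4 * (h * h) * (y * y′) +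
      ι 4 * (y * y′) * (ι 6 * ((l * h) * (A + B)) - ((l * h) * (h * h) + ι 12 * (l * (B - A))))
      ≡⟨ cong (λ u → ι 24 * (B * y′) + ι 4 * (h * h) * (y * y′) +
           ι 4 * (y * y′) * (ι 6 * (u * (A + B)) - (u * (h * h) + ι 12 * (l * (B - A))))) (ι-r n) ⟩
    ι 24 * (B * y′) + ι 4 * (h * h) * (y * y′) +
      ι 4 * (y * y′) * (ι 6 * (1ℚ * (A + B)) - (1ℚ * (h * h) + ι 12 * (l * (B - A))))
      ≡⟨ e₂ A B l h y y′ ⟩
    ι 24 * (B * y′) + ι 24 * (((l + l + 1ℚ) * y′) * (A * y) - ((l + l - 1ℚ) * y) * (B * y′))
      ≡⟨ cong₂ (λ u v → ι 24 * (B * y′) + ι 24 * (u * (A * y) - v * (B * y′))) l≡′ l≡ ⟩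
    ι 24 * (B * y′) + ι 24 * (1ℚ * (A * y) - 1ℚ * (B * y′))
      ≡⟨ e₃ (A * y) (B * y′) ⟩
    ι 24 * (A * y) ∎)
    where
    open ≡-Reasoning
    A = E (4 ℕ.+ J) a
    B = E (4 ℕ.+ J) (a + h)
    key : h * h * h + ι 12 * (B - A) ≤ ι 6 * (h * (A + B))
    key = ℚ.≤-trans (E-trapezoid a h 0≤a (r≥0 n) J)
      (*-monoʳ (ι≥0 6) (*-monoʳ (r≥0 n) (ℚ.+-mono-≤
        (E-≤-suc (3 ℕ.+ J) 0≤a) (E-≤-suc (3 ℕ.+ J) (+-≥0 0≤a (r≥0 n))))))
    e₁ : ∀ A B l h y y′ → (ι 24 * (B * y′) + (h * h) * (ι 2 * y * (ι 2 * y′))) +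
      ι 4 * (y * y′) * (l * (ι 6 * (h * (A + B)) - (h * h * h + ι 12 * (B - A)))) ≡
      ι 24 * (B * y′) + ι 4 * (h * h) * (y * y′) +
      ι 4 * (y * y′) * (ι 6 * ((l * h) * (A + B)) - ((l * h) * (h * h) + ι 12 * (l * (B - A))))
    e₁ = solve-∀ ℚ-ring
    e₂ : ∀ A B l h y y′ → ι 24 * (B * y′) + ι 4 * (h * h) * (y * y′) +
      ι 4 * (y * y′) * (ι 6 * (1ℚ * (A + B)) - (1ℚ * (h * h) + ι 12 * (l * (B - A)))) ≡
      ι 24 * (B * y′) + ι 24 * (((l + l + 1ℚ) * y′) * (A * y) - ((l + l - 1ℚ) * y) * (B * y′))
    e₂ = solve-∀ ℚ-ring
    e₃ : ∀ X Y → ι 24 * Y + ι 24 * (1ℚ * X - 1ℚ * Y) ≡ ι 24 * X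
    e₃ = solve-∀ ℚ-ring

  r≤2r-double : r n ≤ ι 2 * r (n ℕ.+ n)
  r≤2r-double = ≤-from-+ (*-≥0 (r≥0 n) (r≥0 (n ℕ.+ n))) (begin
    h + h * y                              ≡⟨ e₁ h y ⟩
    h * 1ℚ + h * y                         ≡⟨ cong (λ u → h * u + h * y) l≡ ⟨
    h * ((l + l - 1ℚ) * y) + h * y         ≡⟨ e₂ l h y ⟩
    ι 2 * ((l * h) * y)                    ≡⟨ cong (λ u → ι 2 * (u * y)) (ι-r n) ⟩
    ι 2 * (1ℚ * y)                         ≡⟨ cong (_*_ (ι 2)) (ℚ.*-identityˡ y) ⟩
    ι 2 * y                                ∎)
    where
    open ≡-Reasoning
    e₁ : ∀ h y → h + h * y ≡ h * 1ℚ + h * y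
    e₁ = solve-∀ ℚ-ring
    e₂ : ∀ l h y → h * ((l + l - 1ℚ) * y) + h * y ≡ ι 2 * ((l * h) * y)
    e₂ = solve-∀ ℚ-ring

-- Exponentiated form of `R n k` ≤ log((2(n+k)+1)/(2n+1)), with a margin. The steps telescope, and
-- each leaves a surplus of at least ρ⁴, since ρ is below all four factors of the surplus in
-- `E-upper-step`.
E-upper : ∀ k n J a ρ → 0ℚ ≤ a → 0ℚ ≤ ρ → ρ ≤ r (n ℕ.+ k) →
  ι 24 * (E (4 ℕ.+ J) (a + R n k) * r ((n ℕ.+ k) ℕ.+ (n ℕ.+ k))) + ι k * ((ρ * ρ) * (ρ * ρ)) ≤
  ι 24 * (E (4 ℕ.+ J) a * r (n ℕ.+ n))
E-upper zero n J a ρ 0≤a 0≤ρ H = ℚ.≤-reflexive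
  (trans (cong₂ (λ x i → ι 24 * (E (4 ℕ.+ J) x * r (i ℕ.+ i)) + 0ℚ * ((ρ * ρ) * (ρ * ρ)))
           (ℚ.+-identityʳ a) (ℕ.+-identityʳ n))
         (e (ι 24 * (E (4 ℕ.+ J) a * r (n ℕ.+ n))) ((ρ * ρ) * (ρ * ρ))))
  where
  e : ∀ x y → x + 0ℚ * y ≡ x
  e = solve-∀ ℚ-ring
E-upper (suc k) n J a ρ 0≤a 0≤ρ H = begin
  ι 24 * (E (4 ℕ.+ J) (a + R n (suc k)) * r ((n ℕ.+ suc k) ℕ.+ (n ℕ.+ suc k))) + ι (suc k) * ρ⁴
    ≡⟨ cong₂ (λ x i → ι 24 * (E (4 ℕ.+ J) x * r (i ℕ.+ i)) + ι (suc k) * ρ⁴)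
         (sym (ℚ.+-assoc a (r n) (R (suc n) k))) (ℕ.+-suc n k) ⟩
  X + (1ℚ + ι k) * ρ⁴
    ≡⟨ e₁ X (ι k) ρ⁴ ⟩
  X + ι k * ρ⁴ + ρ⁴
    ≤⟨ ℚ.+-mono-≤
         (E-upper k (suc n) J (a + r n) ρ (+-≥0 0≤a (r≥0 n)) 0≤ρ (subst (λ i → ρ ≤ r i) (ℕ.+-suc n k) H))
         (*-mono 0≤ρ² (*-mono 0≤ρ ρ≤r 0≤ρ ρ≤r) 0≤ρ²
           (*-mono 0≤ρ (ℚ.≤-trans ρ≤r (r≤2r-double n)) 0≤ρ (ℚ.≤-trans ρ≤r′ (r≤2r-double (suc n))))) ⟩
  ι 24 * (E (4 ℕ.+ J) (a + r n) * r (suc n ℕ.+ suc n)) +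
    (r n * r n) * (ι 2 * r (n ℕ.+ n) * (ι 2 * r (suc n ℕ.+ suc n)))
    ≤⟨ E-upper-step n J a 0≤a ⟩
  ι 24 * (E (4 ℕ.+ J) a * r (n ℕ.+ n)) ∎
  where
  open ℚ.≤-Reasoning
  ρ⁴ = (ρ * ρ) * (ρ * ρ)
  X = ι 24 * (E (4 ℕ.+ J) (a + r n + R (suc n) k) * r ((suc n ℕ.+ k) ℕ.+ (suc n ℕ.+ k)))
  0≤ρ² : 0ℚ ≤ ρ * ρ
  0≤ρ² = *-≥0 0≤ρ 0≤ρ
  ρ≤r : ρ ≤ r n
  ρ≤r = ℚ.≤-trans H (r-anti (ℕ.m≤m+n n (suc k)))
  ρ≤r′ : ρ ≤ r (suc n)
  ρ≤r′ = ℚ.≤-trans H (r-anti (subst (suc n ℕ.≤_) (sym (ℕ.+-suc n k)) (ℕ.m≤m+n (suc n) k)))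
  e₁ : ∀ x k y → x + (1ℚ + k) * y ≡ x + k * y + y
  e₁ = solve-∀ ℚ-ring

-- Padé approximants of e

-- The Padé approximants of e are p/q with q = 2 padeV + 1 and p = q + 2 padeW; p and q are odd
-- and satisfy x(k+2) = (4k+6) x(k+1) + x(k).
padeW padeV padeQ : ℕ → ℕ
padeW zero          = 0
padeW (suc zero)    = 1
padeW (suc (suc k)) = (4 ℕ.* k ℕ.+ 6) ℕ.* padeW (suc k) ℕ.+ padeW k

padeV zero          = 0
padeV (suc zero)    = 0
padeV (suc (suc k)) = (4 ℕ.* k ℕ.+ 6) ℕ.* padeV (suc k) ℕ.+ padeV k ℕ.+ (2 ℕ.* k ℕ.+ 3)

padeQ k = suc (padeV k ℕ.+ padeV k)

padeQ-rec : ∀ k → padeQ (suc (suc k)) ≡ (4 ℕ.* k ℕ.+ 6) ℕ.* padeQ (suc k) ℕ.+ padeQ k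
padeQ-rec k = e k (padeV (suc k)) (padeV k)
  where
  e : ∀ k x y → let V = (4 ℕ.* k ℕ.+ 6) ℕ.* x ℕ.+ y ℕ.+ (2 ℕ.* k ℕ.+ 3) in
    suc (V ℕ.+ V) ≡ (4 ℕ.* k ℕ.+ 6) ℕ.* suc (x ℕ.+ x) ℕ.+ suc (y ℕ.+ y)
  e = ℕ-Solver.solve-∀

-- The approximation error as a series over factorials

1/! : ℕ → ℚ
1/! j = expTerm j 1ℚ

1/!-suc : ∀ j → ι (suc j) * 1/! (suc j) ≡ 1/! j
1/!-suc j = trans (expTerm-suc j 1ℚ) (ℚ.*-identityʳ (1/! j))

1/!≥0 : ∀ j → 0ℚ ≤ 1/! j
1/!≥0 j = expTerm≥0 j 0≤1

1/!-suc-≤ : ∀ j → 1/! (suc j) ≤ 1/! j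
1/!-suc-≤ j = subst (1/! (suc j) ≤_) (trans (ℚ.*-identityʳ (1/! j * 1ℚ)) (ℚ.*-identityʳ (1/! j)))
  (*-monoʳ (*-≥0 (1/!≥0 j) 0≤1) (r≤1 j))

1/!-anti : ∀ k j → 1/! (k ℕ.+ j) ≤ 1/! j
1/!-anti zero    j = ℚ.≤-refl
1/!-anti (suc k) j = ℚ.≤-trans (1/!-suc-≤ (k ℕ.+ j)) (1/!-anti k j)

1/!≤1 : ∀ j → 1/! j ≤ 1ℚ
1/!≤1 j = subst (λ i → 1/! i ≤ 1ℚ) (ℕ.+-identityʳ j) (1/!-anti j 0)

1/!≤r : ∀ j → 1/! (suc j) ≤ r j
1/!≤r j = subst (1/! (suc j) ≤_) (ℚ.*-identityˡ (r j))
  (*-monoˡ (r≥0 j) (subst (_≤ 1ℚ) (sym (ℚ.*-identityʳ (1/! j))) (1/!≤1 j)))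

1/!>0 : ∀ j → 0ℚ < 1/! j
1/!>0 zero    = 0<1
1/!>0 (suc j) = *->0 (*->0 (1/!>0 j) 0<1) (r>0 j)

!*1/! : ∀ j → ι (j !) * 1/! j ≡ 1ℚ
!*1/! zero    = refl
!*1/! (suc j) = begin
  ι (suc j ℕ.* j !) * 1/! (suc j)          ≡⟨ cong (_* 1/! (suc j)) (ι-* (suc j) (j !)) ⟩
  ι (suc j) * ι (j !) * 1/! (suc j)        ≡⟨ e (ι (suc j)) (ι (j !)) (1/! (suc j)) ⟩
  ι (j !) * (ι (suc j) * 1/! (suc j))      ≡⟨ cong (_*_ (ι (j !))) (1/!-suc j) ⟩
  ι (j !) * 1/! j                          ≡⟨ !*1/! j ⟩
  1ℚ                                     ∎
  where
  open ≡-Reasoning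
  e : ∀ n f x → n * f * x ≡ f * (n * x)
  e = solve-∀ ℚ-ring

-- |q e - p| = (1/k!) ∫₀¹ xᵏ(1-x)ᵏeˣ dx = Σⱼ padeTerm k j, on expanding eˣ.
padeTerm : ℕ → ℕ → ℚ
padeTerm k j = ι ((k ℕ.+ j) !) * (1/! j * 1/! (suc (k ℕ.+ k ℕ.+ j)))

padeTerm>0 : ∀ k j → 0ℚ < padeTerm k j
padeTerm>0 k j = *->0 (ι!>0 (k ℕ.+ j)) (*->0 (1/!>0 j) (1/!>0 (suc (k ℕ.+ k ℕ.+ j))))
  where
  ι!>0 : ∀ n → 0ℚ < ι (n !)
  ι!>0 n = subst (0ℚ <_) (cong ι (ℕ.suc-pred (n !) {{n !≢0}})) (ι>0 (ℕ.pred (n !)))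

padeTerm≥0 : ∀ k j → 0ℚ ≤ padeTerm k j
padeTerm≥0 k j = ℚ.<⇒≤ (padeTerm>0 k j)

padeTerm≤1/! : ∀ k j → padeTerm k j ≤ 1/! j
padeTerm≤1/! k j = begin
  ι ((k ℕ.+ j) !) * (1/! j * 1/! (suc (k ℕ.+ k ℕ.+ j)))
    ≡⟨ cong (λ i → ι ((k ℕ.+ j) !) * (1/! j * 1/! i)) (e₁ k j) ⟩
  ι ((k ℕ.+ j) !) * (1/! j * 1/! (suc k ℕ.+ (k ℕ.+ j)))
    ≤⟨ *-monoʳ (ι≥0 ((k ℕ.+ j) !)) (*-monoʳ (1/!≥0 j) (1/!-anti (suc k) (k ℕ.+ j))) ⟩
  ι ((k ℕ.+ j) !) * (1/! j * 1/! (k ℕ.+ j))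
    ≡⟨ e₂ (ι ((k ℕ.+ j) !)) (1/! j) (1/! (k ℕ.+ j)) ⟩
  ι ((k ℕ.+ j) !) * 1/! (k ℕ.+ j) * 1/! j
    ≡⟨ cong (_* 1/! j) (!*1/! (k ℕ.+ j)) ⟩
  1ℚ * 1/! j
    ≡⟨ ℚ.*-identityˡ (1/! j) ⟩
  1/! j ∎
  where
  open ℚ.≤-Reasoning
  e₁ : ∀ k j → suc (k ℕ.+ k ℕ.+ j) ≡ suc k ℕ.+ (k ℕ.+ j)
  e₁ = ℕ-Solver.solve-∀
  e₂ : ∀ a b c → a * (b * c) ≡ a * c * b
  e₂ = solve-∀ ℚ-ring

-- After division by (k+m)!/(m!(2k+m+3)!) this is (2k+m+2)(2k+m+3) = (4k+6)(k+m+1) + m(m-1). The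
-- factor m(m-1) then turns 1/m! into 1/(m-2)!, or vanishes for m < 2.
padeTerm-contiguous : ∀ k m → padeTerm k m ≡ ι (4 ℕ.* k ℕ.+ 6) * padeTerm (suc k) m +
  ι m * (ι m - 1ℚ) * (ι ((k ℕ.+ m) !) * (1/! m * 1/! (3 ℕ.+ (k ℕ.+ k ℕ.+ m))))
padeTerm-contiguous k m = begin
  F * (1/! m * 1/! (suc s))
    ≡⟨ cong (λ u → F * (1/! m * u)) (trans (sym (1/!-suc (suc s)))
         (cong (_*_ (ι (2 ℕ.+ s))) (sym (1/!-suc (suc (suc s)))))) ⟩
  F * (1/! m * ((1ℚ + (1ℚ + ι s)) * ((1ℚ + (1ℚ + (1ℚ + ι s))) * B)))
    ≡⟨ cong (λ u → F * (1/! m * ((1ℚ + (1ℚ + u)) * ((1ℚ + (1ℚ + (1ℚ + u))) * B)))) ιs ⟩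
  F * (1/! m * ((1ℚ + (1ℚ + (K + K + M))) * ((1ℚ + (1ℚ + (1ℚ + (K + K + M)))) * B)))
    ≡⟨ e F (1/! m) B K M ⟩
  (ι 4 * K + ι 6) * ((1ℚ + (K + M)) * F * (1/! m * B)) + M * (M - 1ℚ) * (F * (1/! m * B))
    ≡⟨ cong₂ (λ c u → c * (u * (1/! m * B)) + M * (M - 1ℚ) * (F * (1/! m * B)))
         (sym (trans (ι-+ (4 ℕ.* k) 6) (cong (_+ ι 6) (ι-* 4 k))))
         (sym (trans (ι-* (suc (k ℕ.+ m)) ((k ℕ.+ m) !)) (cong (λ u → (1ℚ + u) * F) (ι-+ k m)))) ⟩
  ι (4 ℕ.* k ℕ.+ 6) * (ι (suc (k ℕ.+ m) !) * (1/! m * B)) + M * (M - 1ℚ) * (F * (1/! m * B))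
    ≡⟨ cong (λ i → ι (4 ℕ.* k ℕ.+ 6) * (ι (suc (k ℕ.+ m) !) * (1/! m * 1/! i)) + M * (M - 1ℚ) * (F * (1/! m * B)))
         (e₁ k m) ⟩
  ι (4 ℕ.* k ℕ.+ 6) * padeTerm (suc k) m + M * (M - 1ℚ) * (F * (1/! m * B)) ∎
  where
  open ≡-Reasoning
  s = k ℕ.+ k ℕ.+ m
  F = ι ((k ℕ.+ m) !)
  K = ι k
  M = ι m
  B = 1/! (3 ℕ.+ s)
  ιs : ι s ≡ K + K + M
  ιs = trans (ι-+ (k ℕ.+ k) m) (cong (_+ M) (ι-+ k k))
  e₁ : ∀ k m → 3 ℕ.+ (k ℕ.+ k ℕ.+ m) ≡ suc (suc k ℕ.+ suc k ℕ.+ m)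
  e₁ = ℕ-Solver.solve-∀
  e : ∀ F f B K M → F * (f * ((1ℚ + (1ℚ + (K + K + M))) * ((1ℚ + (1ℚ + (1ℚ + (K + K + M)))) * B)))
    ≡ (ι 4 * K + ι 6) * ((1ℚ + (K + M)) * F * (f * B)) + M * (M - 1ℚ) * (F * (f * B))
  e = solve-∀ ℚ-ring

padeTerm-rec₀ : ∀ k → padeTerm k 0 ≡ ι (4 ℕ.* k ℕ.+ 6) * padeTerm (suc k) 0
padeTerm-rec₀ k = trans (padeTerm-contiguous k 0)
  (e (ι (4 ℕ.* k ℕ.+ 6) * padeTerm (suc k) 0) (ι ((k ℕ.+ 0) !) * (1/! 0 * 1/! (3 ℕ.+ (k ℕ.+ k ℕ.+ 0)))))
  where
  e : ∀ x y → x + ι 0 * (ι 0 - 1ℚ) * y ≡ x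
  e = solve-∀ ℚ-ring

padeTerm-rec₁ : ∀ k → padeTerm k 1 ≡ ι (4 ℕ.* k ℕ.+ 6) * padeTerm (suc k) 1
padeTerm-rec₁ k = trans (padeTerm-contiguous k 1)
  (e (ι (4 ℕ.* k ℕ.+ 6) * padeTerm (suc k) 1) (ι ((k ℕ.+ 1) !) * (1/! 1 * 1/! (3 ℕ.+ (k ℕ.+ k ℕ.+ 1)))))
  where
  e : ∀ x y → x + ι 1 * (ι 1 - 1ℚ) * y ≡ x
  e = solve-∀ ℚ-ring

padeTerm-rec : ∀ k j → padeTerm k (suc (suc j)) ≡
  ι (4 ℕ.* k ℕ.+ 6) * padeTerm (suc k) (suc (suc j)) + padeTerm (suc (suc k)) j
padeTerm-rec k j = trans (padeTerm-contiguous k (suc (suc j)))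
  (cong (_+_ (ι (4 ℕ.* k ℕ.+ 6) * padeTerm (suc k) (suc (suc j)))) (begin
  (1ℚ + (1ℚ + ι j)) * ((1ℚ + (1ℚ + ι j)) - 1ℚ) * (F * (f * B))
    ≡⟨ e (ι j) F f B ⟩
  F * (((1ℚ + ι j) * ((1ℚ + (1ℚ + ι j)) * f)) * B)
    ≡⟨ cong (λ u → F * (u * B)) (trans (cong (_*_ (ι (suc j))) (1/!-suc (suc j))) (1/!-suc j)) ⟩
  F * (1/! j * B)
    ≡⟨ cong₂ (λ i i′ → ι (i !) * (1/! j * 1/! i′)) (e₁ k j) (e₂ k j) ⟩
  padeTerm (suc (suc k)) j ∎))
  where
  open ≡-Reasoning
  F = ι ((k ℕ.+ suc (suc j)) !)
  f = 1/! (suc (suc j))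
  B = 1/! (3 ℕ.+ (k ℕ.+ k ℕ.+ suc (suc j)))
  e : ∀ j F f B → (1ℚ + (1ℚ + j)) * ((1ℚ + (1ℚ + j)) - 1ℚ) * (F * (f * B))
    ≡ F * (((1ℚ + j) * ((1ℚ + (1ℚ + j)) * f)) * B)
  e = solve-∀ ℚ-ring
  e₁ : ∀ k j → k ℕ.+ suc (suc j) ≡ suc (suc k) ℕ.+ j
  e₁ = ℕ-Solver.solve-∀
  e₂ : ∀ k j → 3 ℕ.+ (k ℕ.+ k ℕ.+ suc (suc j)) ≡ suc (suc (suc k) ℕ.+ suc (suc k) ℕ.+ j)
  e₂ = ℕ-Solver.solve-∀

padeRemainder : ℕ → ℕ → ℚ
padeRemainder k zero    = 0ℚ
padeRemainder k (suc J) = padeRemainder k J + padeTerm k J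

-- The last remainder is two terms shorter: the terms of index 0 and 1 contribute nothing to it, and
-- later ones arrive with index lowered by two.
padeRemainder-rec : ∀ k J → padeRemainder k (suc (suc J)) ≡
  ι (4 ℕ.* k ℕ.+ 6) * padeRemainder (suc k) (suc (suc J)) + padeRemainder (suc (suc k)) J
padeRemainder-rec k zero = trans (cong₂ (λ x y → 0ℚ + x + y) (padeTerm-rec₀ k) (padeTerm-rec₁ k))
  (e (ι (4 ℕ.* k ℕ.+ 6)) (padeTerm (suc k) 0) (padeTerm (suc k) 1))
  where
  e : ∀ c x y → 0ℚ + c * x + c * y ≡ c * (0ℚ + x + y) + 0ℚ
  e = solve-∀ ℚ-ring
padeRemainder-rec k (suc J) = trans (cong₂ _+_ (padeRemainder-rec k J) (padeTerm-rec k J))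
  (e (ι (4 ℕ.* k ℕ.+ 6)) (padeRemainder (suc k) (suc (suc J))) (padeRemainder (suc (suc k)) J)
     (padeTerm (suc k) (suc (suc J))) (padeTerm (suc (suc k)) J))
  where
  e : ∀ c x y x′ y′ → c * x + y + (c * x′ + y′) ≡ c * (x + x′) + (y + y′)
  e = solve-∀ ℚ-ring

padeTerm₀ : ∀ j → padeTerm 0 j ≡ 1/! (suc j)
padeTerm₀ j = trans (e (ι (j !)) (1/! j) (1/! (suc j)))
  (trans (cong (_* 1/! (suc j)) (!*1/! j)) (ℚ.*-identityˡ (1/! (suc j))))
  where
  e : ∀ a b c → a * (b * c) ≡ a * b * c
  e = solve-∀ ℚ-ring

padeTerm₁ : ∀ j → padeTerm 1 j ≡ ι (suc j) * 1/! (3 ℕ.+ j)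
padeTerm₁ j = begin
  ι (suc j ℕ.* j !) * (1/! j * 1/! (3 ℕ.+ j))            ≡⟨ cong (_* (1/! j * 1/! (3 ℕ.+ j))) (ι-* (suc j) (j !)) ⟩
  ι (suc j) * ι (j !) * (1/! j * 1/! (3 ℕ.+ j))          ≡⟨ e (ι (suc j)) (ι (j !)) (1/! j) (1/! (3 ℕ.+ j)) ⟩
  ι (suc j) * (ι (j !) * 1/! j * 1/! (3 ℕ.+ j))          ≡⟨ cong (λ u → ι (suc j) * (u * 1/! (3 ℕ.+ j))) (!*1/! j) ⟩
  ι (suc j) * (1ℚ * 1/! (3 ℕ.+ j))                     ≡⟨ cong (_*_ (ι (suc j))) (ℚ.*-identityˡ (1/! (3 ℕ.+ j))) ⟩
  ι (suc j) * 1/! (3 ℕ.+ j)                            ∎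
  where
  open ≡-Reasoning
  e : ∀ n a b c → n * a * (b * c) ≡ n * (a * b * c)
  e = solve-∀ ℚ-ring

padeRemainder₀ : ∀ J → E (suc J) 1ℚ - 1ℚ ≡ padeRemainder 0 J
padeRemainder₀ zero    = refl
padeRemainder₀ (suc J) = trans (e (E (suc J) 1ℚ) (1/! (suc J))) (cong₂ _+_ (padeRemainder₀ J) (sym (padeTerm₀ J)))
  where
  e : ∀ x y → x + y - 1ℚ ≡ (x - 1ℚ) + y
  e = solve-∀ ℚ-ring

-- Truncation of 3 - e = Σ (j+1)/(j+3)!, with its exact error.
padeRemainder₁ : ∀ J → ι 2 - padeRemainder 0 J - padeRemainder 1 J ≡ 1/! (suc J) + ι 2 * 1/! (2 ℕ.+ J)
padeRemainder₁ zero    = refl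
padeRemainder₁ (suc J) = begin
  ι 2 - (padeRemainder 0 J + padeTerm 0 J) - (padeRemainder 1 J + padeTerm 1 J)
    ≡⟨ cong₂ (λ x y → ι 2 - (padeRemainder 0 J + x) - (padeRemainder 1 J + y)) (padeTerm₀ J) (padeTerm₁ J) ⟩
  ι 2 - (padeRemainder 0 J + 1/! (suc J)) - (padeRemainder 1 J + (1ℚ + ι J) * B)
    ≡⟨ e₁ (padeRemainder 0 J) (padeRemainder 1 J) (1/! (suc J)) (ι J) B ⟩
  (ι 2 - padeRemainder 0 J - padeRemainder 1 J) - 1/! (suc J) - (1ℚ + ι J) * B
    ≡⟨ cong (λ u → u - 1/! (suc J) - (1ℚ + ι J) * B) (padeRemainder₁ J) ⟩
  (1/! (suc J) + ι 2 * 1/! (2 ℕ.+ J)) - 1/! (suc J) - (1ℚ + ι J) * B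
    ≡⟨ e₂ (1/! (suc J)) (1/! (2 ℕ.+ J)) (ι J) B ⟩
  1/! (2 ℕ.+ J) + 1/! (2 ℕ.+ J) - (1ℚ + ι J) * B
    ≡⟨ cong (λ u → 1/! (2 ℕ.+ J) + u - (1ℚ + ι J) * B) (1/!-suc (2 ℕ.+ J)) ⟨
  1/! (2 ℕ.+ J) + (1ℚ + (1ℚ + (1ℚ + ι J))) * B - (1ℚ + ι J) * B
    ≡⟨ e₃ (1/! (2 ℕ.+ J)) (ι J) B ⟩
  1/! (2 ℕ.+ J) + ι 2 * B ∎
  where
  open ≡-Reasoning
  B = 1/! (3 ℕ.+ J)
  e₁ : ∀ x y f j B → ι 2 - (x + f) - (y + (1ℚ + j) * B) ≡ (ι 2 - x - y) - f - (1ℚ + j) * B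
  e₁ = solve-∀ ℚ-ring
  e₂ : ∀ f g j B → (f + ι 2 * g) - f - (1ℚ + j) * B ≡ g + g - (1ℚ + j) * B
  e₂ = solve-∀ ℚ-ring
  e₃ : ∀ g j B → g + (1ℚ + (1ℚ + (1ℚ + j))) * B - (1ℚ + j) * B ≡ g + ι 2 * B
  e₃ = solve-∀ ℚ-ring

-- (-1)ᵏ (q (1+z) - p), where z stands for a truncation of e - 1; see padeError-even, padeError-odd.
padeError : ℕ → ℚ → ℚ
padeError zero          z = z
padeError (suc zero)    z = ι 2 - z
padeError (suc (suc k)) z = padeError k z - ι (4 ℕ.* k ℕ.+ 6) * padeError (suc k) z

∣error∣-bound : ∀ {f₀ f₁ t₀ t₁ c C₀ C₁ x} → 0ℚ ≤ c → ∣ f₀ ∣ ≤ C₀ * x → ∣ f₁ ∣ ≤ C₁ * x →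
  0ℚ ≤ t₀ → t₀ ≤ x → 0ℚ ≤ t₁ → t₁ ≤ x →
  ∣ f₀ - c * f₁ - (t₀ + t₁) ∣ ≤ (C₀ + c * C₁ + ι 2) * x
∣error∣-bound {f₀} {f₁} {t₀} {t₁} {c} {C₀} {C₁} {x} 0≤c f₀≤ f₁≤ 0≤t₀ t₀≤ 0≤t₁ t₁≤ = begin
  ∣ f₀ - c * f₁ - (t₀ + t₁) ∣
    ≤⟨ ℚ.≤-trans (ℚ.∣p-q∣≤∣p∣+∣q∣ (f₀ - c * f₁) (t₀ + t₁))
         (ℚ.+-monoˡ-≤ ∣ t₀ + t₁ ∣ (ℚ.∣p-q∣≤∣p∣+∣q∣ f₀ (c * f₁))) ⟩
  ∣ f₀ ∣ + ∣ c * f₁ ∣ + ∣ t₀ + t₁ ∣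
    ≡⟨ cong₂ (λ y z → ∣ f₀ ∣ + y + z)
         (trans (ℚ.∣p*q∣≡∣p∣*∣q∣ c f₁) (cong (_* ∣ f₁ ∣) (ℚ.0≤p⇒∣p∣≡p 0≤c)))
         (ℚ.0≤p⇒∣p∣≡p (+-≥0 0≤t₀ 0≤t₁)) ⟩
  ∣ f₀ ∣ + c * ∣ f₁ ∣ + (t₀ + t₁)
    ≤⟨ ℚ.+-mono-≤ (ℚ.+-mono-≤ f₀≤ (*-monoʳ 0≤c f₁≤)) (ℚ.+-mono-≤ t₀≤ t₁≤) ⟩
  C₀ * x + c * (C₁ * x) + (x + x)
    ≡⟨ e₂ C₀ c C₁ x ⟩
  (C₀ + c * C₁ + ι 2) * x ∎
  where
  open ℚ.≤-Reasoning
  e₂ : ∀ C₀ c C₁ f → C₀ * f + c * (C₁ * f) + (f + f) ≡ (C₀ + c * C₁ + ι 2) * f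
  e₂ = solve-∀ ℚ-ring

-- Replaces equality of `padeError k` at e - 1 with the full series: both sides are truncated, and
-- the gap vanishes as J grows because `C` depends on `k` alone.
ApproximatesRemainder : ℕ → Set
ApproximatesRemainder k = ∃[ C ] (0ℚ ≤ C × ∀ J →
  ∣ padeError k (padeRemainder 0 (2 ℕ.+ J)) - padeRemainder k (2 ℕ.+ J) ∣ ≤ C * 1/! J)

-- Both sides obey the same recurrence, except that `padeRemainder-rec` yields a sum two terms
-- short. Those two terms are each at most `1/! J` and account for the `ι 2` in the new constant.
padeError≈padeRemainder-suc : ∀ k →
  ApproximatesRemainder k → ApproximatesRemainder (suc k) → ApproximatesRemainder (suc (suc k))
padeError≈padeRemainder-suc k (C₀ , 0≤C₀ , H₀) (C₁ , 0≤C₁ , H₁) =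
  C₀ + c * C₁ + ι 2 , +-≥0 (+-≥0 0≤C₀ (*-≥0 0≤c 0≤C₁)) (ι≥0 2) , λ J →
    subst (λ u → ∣ u ∣ ≤ (C₀ + c * C₁ + ι 2) * 1/! J) (sym (eq J))
      (∣error∣-bound {C₀ = C₀} {C₁} {1/! J} 0≤c (H₀ J) (H₁ J) (padeTerm≥0 (2 ℕ.+ k) J) (padeTerm≤1/! (2 ℕ.+ k) J)
        (padeTerm≥0 (2 ℕ.+ k) (suc J)) (ℚ.≤-trans (padeTerm≤1/! (2 ℕ.+ k) (suc J)) (1/!-suc-≤ J)))
  where
  c = ι (4 ℕ.* k ℕ.+ 6)
  0≤c : 0ℚ ≤ c
  0≤c = ι≥0 (4 ℕ.* k ℕ.+ 6)
  e₁ : ∀ a₀ c a₁ u₁ u₂ t₀ t₁ → (a₀ - c * a₁) - (u₂ + t₀ + t₁) ≡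
    a₀ - (c * u₁ + u₂) - c * (a₁ - u₁) - (t₀ + t₁)
  e₁ = solve-∀ ℚ-ring
  eq : ∀ J → padeError (2 ℕ.+ k) (padeRemainder 0 (2 ℕ.+ J)) - padeRemainder (2 ℕ.+ k) (2 ℕ.+ J) ≡
    (padeError k (padeRemainder 0 (2 ℕ.+ J)) - padeRemainder k (2 ℕ.+ J)) -
    c * (padeError (suc k) (padeRemainder 0 (2 ℕ.+ J)) - padeRemainder (suc k) (2 ℕ.+ J)) -
    (padeTerm (2 ℕ.+ k) J + padeTerm (2 ℕ.+ k) (suc J))
  eq J = trans
    (e₁ (padeError k (padeRemainder 0 (2 ℕ.+ J))) c (padeError (suc k) (padeRemainder 0 (2 ℕ.+ J)))
        (padeRemainder (suc k) (2 ℕ.+ J)) (padeRemainder (2 ℕ.+ k) J)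
        (padeTerm (2 ℕ.+ k) J) (padeTerm (2 ℕ.+ k) (suc J)))
    (cong (λ u → padeError k (padeRemainder 0 (2 ℕ.+ J)) - u -
                 c * (padeError (suc k) (padeRemainder 0 (2 ℕ.+ J)) - padeRemainder (suc k) (2 ℕ.+ J)) -
                 (padeTerm (2 ℕ.+ k) J + padeTerm (2 ℕ.+ k) (suc J))) (sym (padeRemainder-rec k J)))

padeError≈padeRemainder : ∀ k → ApproximatesRemainder k
padeError≈padeRemainder zero = 0ℚ , ℚ.≤-refl , λ J → ℚ.≤-reflexive
  (trans (cong ∣_∣ (ℚ.+-inverseʳ (padeRemainder 0 (2 ℕ.+ J)))) (sym (ℚ.*-zeroˡ (1/! J))))
padeError≈padeRemainder (suc zero) = ι 3 , ι≥0 3 , λ J → begin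
  ∣ ι 2 - padeRemainder 0 (2 ℕ.+ J) - padeRemainder 1 (2 ℕ.+ J) ∣
    ≡⟨ cong ∣_∣ (padeRemainder₁ (2 ℕ.+ J)) ⟩
  ∣ 1/! (3 ℕ.+ J) + ι 2 * 1/! (4 ℕ.+ J) ∣
    ≡⟨ ℚ.0≤p⇒∣p∣≡p (+-≥0 (1/!≥0 (3 ℕ.+ J)) (*-≥0 (ι≥0 2) (1/!≥0 (4 ℕ.+ J)))) ⟩
  1/! (3 ℕ.+ J) + ι 2 * 1/! (4 ℕ.+ J)
    ≤⟨ ℚ.+-mono-≤ (1/!-anti 3 J) (*-monoʳ (ι≥0 2) (1/!-anti 4 J)) ⟩
  1/! J + ι 2 * 1/! J
    ≡⟨ e (1/! J) ⟩
  ι 3 * 1/! J ∎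
  where
  open ℚ.≤-Reasoning
  e : ∀ x → x + ι 2 * x ≡ ι 3 * x
  e = solve-∀ ℚ-ring
padeError≈padeRemainder (suc (suc k)) =
  padeError≈padeRemainder-suc k (padeError≈padeRemainder k) (padeError≈padeRemainder (suc k))

padeTerm≤padeRemainder : ∀ k J → padeTerm k 0 ≤ padeRemainder k (suc J)
padeTerm≤padeRemainder k zero    = ℚ.≤-reflexive (sym (ℚ.+-identityˡ (padeTerm k 0)))
padeTerm≤padeRemainder k (suc J) = ℚ.≤-trans (padeTerm≤padeRemainder k J) (≤-from-+ (padeTerm≥0 k (suc J)) refl)

archimedean-* : ∀ C η → 0ℚ < η → ∃[ n ] C ≤ η * ι n
archimedean-* C η 0<η = n , (begin
  C                     ≡⟨ ℚ.*-identityʳ C ⟨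
  C * 1ℚ                ≡⟨ cong (_*_ C) (ℚ.*-inverseˡ η) ⟨
  C * (1/ η * η)        ≡⟨ ℚ.*-assoc C (1/ η) η ⟨
  C * 1/ η * η          ≤⟨ *-monoˡ (ℚ.<⇒≤ 0<η) (proj₂ (archimedean (C * 1/ η))) ⟩
  ι n * η               ≡⟨ ℚ.*-comm (ι n) η ⟩
  η * ι n               ∎)
  where
  open ℚ.≤-Reasoning
  instance
    η≢0 : NonZero η
    η≢0 = ℚ.pos⇒nonZero η {{positive 0<η}}
  n = proj₁ (archimedean (C * 1/ η))

-- The remainder is at least its first term. Once the truncation gap is below half of that term, the
-- other half is a margin valid for all longer truncations.
padeError-bounded-below : ∀ k → ∃[ η ] (0ℚ < η × ∃[ N ] (∀ J → η ≤ padeError k (E (J ℕ.+ N) 1ℚ - 1ℚ)))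
padeError-bounded-below k with C , 0≤C , H ← padeError≈padeRemainder k = η , 0<η , 4 ℕ.+ n , bound
  where
  open ℚ.≤-Reasoning
  η = padeTerm k 0 * ½
  0<η : 0ℚ < η
  0<η = *->0 (padeTerm>0 k 0) (ℚ.positive⁻¹ ½)
  n = proj₁ (archimedean-* C η 0<η)
  C1/!≤η : ∀ J → C * 1/! (J ℕ.+ suc n) ≤ η
  C1/!≤η J = begin
    C * 1/! (J ℕ.+ suc n)    ≤⟨ *-monoʳ 0≤C (ℚ.≤-trans (1/!-anti J (suc n)) (1/!≤r n)) ⟩
    C * r n                ≤⟨ *-monoˡ (r≥0 n) (proj₂ (archimedean-* C η 0<η)) ⟩
    η * ι n * r n          ≤⟨ *-monoˡ (r≥0 n) (*-monoʳ (ℚ.<⇒≤ 0<η) (ι-mono (ℕ.n≤1+n n))) ⟩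
    η * ι (suc n) * r n    ≡⟨ ℚ.*-assoc η (ι (suc n)) (r n) ⟩
    η * (ι (suc n) * r n)  ≡⟨ cong (_*_ η) (ι-r n) ⟩
    η * 1ℚ                 ≡⟨ ℚ.*-identityʳ η ⟩
    η                      ∎
  e₀ : ∀ x → x * ½ ≡ x - x * ½
  e₀ = solve-∀ ℚ-ring
  neg-minus : ∀ x y → - (x - y) ≡ y - x
  neg-minus = solve-∀ ℚ-ring
  x≤∣x∣ : ∀ x y → y - x ≤ ∣ x - y ∣
  x≤∣x∣ x y = subst₂ _≤_ (neg-minus x y) (ℚ.∣-p∣≡∣p∣ (x - y)) (lemma (- (x - y)))
    where
    lemma : ∀ x → x ≤ ∣ x ∣
    lemma x with ℚ.≤-total 0ℚ x
    ... | inj₁ 0≤x = ℚ.≤-reflexive (sym (ℚ.0≤p⇒∣p∣≡p 0≤x))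
    ... | inj₂ x≤0 = ℚ.≤-trans x≤0 (ℚ.0≤∣p∣ x)
  bound : ∀ J → η ≤ padeError k (E (J ℕ.+ (4 ℕ.+ n)) 1ℚ - 1ℚ)
  bound J = begin
    η                        ≡⟨ e₀ (padeTerm k 0) ⟩
    padeTerm k 0 - η                ≤⟨ ℚ.+-mono-≤ (padeTerm≤padeRemainder k (suc J′)) (ℚ.neg-antimono-≤
      (ℚ.≤-trans (ℚ.≤-trans (x≤∣x∣ A V) (H J′)) (C1/!≤η J))) ⟩
    V - (V - A)              ≡⟨ e₂ V A ⟩
    A                        ≡⟨ cong (padeError k) (sym (padeRemainder₀ (2 ℕ.+ J′))) ⟩
    padeError k (E (3 ℕ.+ J′) 1ℚ - 1ℚ) ≡⟨ cong (λ i → padeError k (E i 1ℚ - 1ℚ)) (e₃ J n) ⟩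
    padeError k (E (J ℕ.+ (4 ℕ.+ n)) 1ℚ - 1ℚ) ∎
    where
    J′ = J ℕ.+ suc n
    V = padeRemainder k (2 ℕ.+ J′)
    A = padeError k (padeRemainder 0 (2 ℕ.+ J′))
    e₂ : ∀ V A → V - (V - A) ≡ A
    e₂ = solve-∀ ℚ-ring
    e₃ : ∀ J n → 3 ℕ.+ (J ℕ.+ suc n) ≡ J ℕ.+ (4 ℕ.+ n)
    e₃ = ℕ-Solver.solve-∀

-- Sizes, determinants and signs of the approximants

double : ℕ → ℕ
double zero    = zero
double (suc i) = suc (suc (double i))

i≤double : ∀ i → i ℕ.≤ double i
i≤double zero    = ℕ.z≤n
i≤double (suc i) = ℕ.s≤s (ℕ.m≤n⇒m≤1+n (i≤double i))

-- With `padeQ≤2padeW` this confines 2w/q, an approximation to e - 1, to [1, 2], the only size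
-- information that `q′-bounded` takes.
padeW≤padeQ : ∀ k → padeW k ℕ.≤ padeQ k
padeW≤padeQ zero          = ℕ.z≤n
padeW≤padeQ (suc zero)    = ℕ.≤-refl
padeW≤padeQ (suc (suc k)) = subst (padeW (2 ℕ.+ k) ℕ.≤_) (sym (padeQ-rec k))
  (ℕ.+-mono-≤ (ℕ.*-monoʳ-≤ (4 ℕ.* k ℕ.+ 6) (padeW≤padeQ (suc k))) (padeW≤padeQ k))

padeQ≤2padeW : ∀ k → padeQ (suc k) ℕ.≤ 2 ℕ.* padeW (suc k)
padeQ≤2padeW zero          = ℕ.s≤s ℕ.z≤n
padeQ≤2padeW (suc zero)    = ℕ.m≤m+n 7 5
padeQ≤2padeW (suc (suc k)) = subst₂ ℕ._≤_ (sym (padeQ-rec (suc k))) (e c (padeW (2 ℕ.+ k)) (padeW (suc k)))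
  (ℕ.+-mono-≤ (ℕ.*-monoʳ-≤ c (padeQ≤2padeW (suc k))) (padeQ≤2padeW k))
  where
  c = 4 ℕ.* suc k ℕ.+ 6
  e : ∀ c x y → c ℕ.* (2 ℕ.* x) ℕ.+ 2 ℕ.* y ≡ 2 ℕ.* (c ℕ.* x ℕ.+ y)
  e = ℕ-Solver.solve-∀

-- The determinant of neighbouring solutions changes sign at each step of the recurrence, so the
-- parities are separated to stay in ℕ. Since p = q + 2w, the determinant of the fractions p/q is
-- ±2.
det-even : ∀ i → let k = double i in padeW (suc k) ℕ.* padeQ k ≡ padeW k ℕ.* padeQ (suc k) ℕ.+ 1
det-odd  : ∀ i → let k = double i in
  padeW (suc k) ℕ.* padeQ (suc (suc k)) ≡ padeW (suc (suc k)) ℕ.* padeQ (suc k) ℕ.+ 1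

-- `d` and `d′` are 0 and 1 in either order, so that one statement serves both signs.
det-step : ∀ w₀ w₁ q₀ q₁ c d d′ → w₁ ℕ.* q₀ ℕ.+ d ≡ w₀ ℕ.* q₁ ℕ.+ d′ →
  w₁ ℕ.* (c ℕ.* q₁ ℕ.+ q₀) ℕ.+ d ≡ (c ℕ.* w₁ ℕ.+ w₀) ℕ.* q₁ ℕ.+ d′
det-step w₀ w₁ q₀ q₁ c d d′ H = trans (e₁ w₁ q₀ q₁ c d)
  (trans (cong (ℕ._+_ (c ℕ.* w₁ ℕ.* q₁)) H) (e₂ w₀ w₁ q₁ c d′))
  where
  e₁ : ∀ w₁ q₀ q₁ c d → w₁ ℕ.* (c ℕ.* q₁ ℕ.+ q₀) ℕ.+ d ≡ c ℕ.* w₁ ℕ.* q₁ ℕ.+ (w₁ ℕ.* q₀ ℕ.+ d)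
  e₁ = ℕ-Solver.solve-∀
  e₂ : ∀ w₀ w₁ q₁ c d → c ℕ.* w₁ ℕ.* q₁ ℕ.+ (w₀ ℕ.* q₁ ℕ.+ d) ≡ (c ℕ.* w₁ ℕ.+ w₀) ℕ.* q₁ ℕ.+ d
  e₂ = ℕ-Solver.solve-∀

det-even zero    = refl
det-even (suc i) = trans
  (sym (trans
    (det-step (padeW k) (padeW (suc k)) (padeQ k) (padeQ (suc k)) c 1 0
      (trans (sym (det-odd i)) (sym (ℕ.+-identityʳ (padeW k ℕ.* padeQ (suc k))))))
    (ℕ.+-identityʳ (padeW (2 ℕ.+ k) ℕ.* padeQ (suc k)))))
  (cong (λ x → padeW (suc k) ℕ.* x ℕ.+ 1) (sym (padeQ-rec k)))
  where
  k = suc (double i)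
  c = 4 ℕ.* k ℕ.+ 6
det-odd i = trans (cong (padeW (suc k) ℕ.*_) (padeQ-rec k))
  (trans (sym (ℕ.+-identityʳ (padeW (suc k) ℕ.* (c ℕ.* padeQ (suc k) ℕ.+ padeQ k))))
    (det-step (padeW k) (padeW (suc k)) (padeQ k) (padeQ (suc k)) c 0 1
      (trans (ℕ.+-identityʳ (padeW (suc k) ℕ.* padeQ k)) (det-even i))))
  where
  k = double i
  c = 4 ℕ.* k ℕ.+ 6

ι-rec : ∀ c x y → ι (c ℕ.* x ℕ.+ y) ≡ ι c * ι x + ι y
ι-rec c x y = trans (ι-+ (c ℕ.* x) y) (cong (_+ ι y) (ι-* c x))

padeError-even : ∀ i z → let k = double i in padeError k z ≡ z * ι (padeQ k) - ι 2 * ι (padeW k)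
padeError-odd  : ∀ i z → let k = suc (double i) in padeError k z ≡ ι 2 * ι (padeW k) - z * ι (padeQ k)

padeError-even zero z = e z
  where
  e : ∀ z → z ≡ z * 1ℚ - ι 2 * 0ℚ
  e = solve-∀ ℚ-ring
padeError-even (suc i) z = begin
  padeError k z - c * padeError (suc k) z
    ≡⟨ cong₂ (λ x y → x - c * y) (padeError-even i z) (padeError-odd i z) ⟩
  (z * ι (padeQ k) - ι 2 * ι (padeW k)) - c * (ι 2 * ι (padeW (suc k)) - z * ι (padeQ (suc k)))
    ≡⟨ e z c (ι (padeQ k)) (ι (padeW k)) (ι (padeQ (suc k))) (ι (padeW (suc k))) ⟩
  z * (c * ι (padeQ (suc k)) + ι (padeQ k)) - ι 2 * (c * ι (padeW (suc k)) + ι (padeW k))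
    ≡⟨ cong₂ (λ x y → z * x - ι 2 * y)
         (sym (trans (cong ι (padeQ-rec k)) (ι-rec (4 ℕ.* k ℕ.+ 6) (padeQ (suc k)) (padeQ k))))
         (sym (ι-rec (4 ℕ.* k ℕ.+ 6) (padeW (suc k)) (padeW k))) ⟩
  z * ι (padeQ (suc (suc k))) - ι 2 * ι (padeW (suc (suc k))) ∎
  where
  open ≡-Reasoning
  k = double i
  c = ι (4 ℕ.* k ℕ.+ 6)
  e : ∀ z c q₀ w₀ q₁ w₁ → (z * q₀ - ι 2 * w₀) - c * (ι 2 * w₁ - z * q₁) ≡
    z * (c * q₁ + q₀) - ι 2 * (c * w₁ + w₀)
  e = solve-∀ ℚ-ring
padeError-odd zero z = e z
  where
  e : ∀ z → ι 2 - z ≡ ι 2 * 1ℚ - z * 1ℚ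
  e = solve-∀ ℚ-ring
padeError-odd (suc i) z = begin
  padeError k z - c * padeError (suc k) z
    ≡⟨ cong₂ (λ x y → x - c * y) (padeError-odd i z) (padeError-even (suc i) z) ⟩
  (ι 2 * ι (padeW k) - z * ι (padeQ k)) - c * (z * ι (padeQ (suc k)) - ι 2 * ι (padeW (suc k)))
    ≡⟨ e z c (ι (padeQ k)) (ι (padeW k)) (ι (padeQ (suc k))) (ι (padeW (suc k))) ⟩
  ι 2 * (c * ι (padeW (suc k)) + ι (padeW k)) - z * (c * ι (padeQ (suc k)) + ι (padeQ k))
    ≡⟨ cong₂ (λ x y → ι 2 * y - z * x)
         (sym (trans (cong ι (padeQ-rec k)) (ι-rec (4 ℕ.* k ℕ.+ 6) (padeQ (suc k)) (padeQ k))))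
         (sym (ι-rec (4 ℕ.* k ℕ.+ 6) (padeW (suc k)) (padeW k))) ⟩
  ι 2 * ι (padeW (suc (suc k))) - z * ι (padeQ (suc (suc k))) ∎
  where
  open ≡-Reasoning
  k = suc (double i)
  c = ι (4 ℕ.* k ℕ.+ 6)
  e : ∀ z c q₀ w₀ q₁ w₁ → (ι 2 * w₀ - z * q₀) - c * (z * q₁ - ι 2 * w₁) ≡
    ι 2 * (c * w₁ + w₀) - z * (c * q₁ + q₀)
  e = solve-∀ ℚ-ring

-- The sums attached to one approximant

-- S κ is the sum over 1/ℓ with n ≤ ℓ ≤ m, where (2m+1, 2n-1) = (2κ+1) (p, q); first κ = n-1.
module Family (v w : ℕ) where
  q = suc (v ℕ.+ v)
  u = v ℕ.+ w
  p = suc (u ℕ.+ u)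

  first len : ℕ → ℕ
  first κ = κ ℕ.* q ℕ.+ v
  len κ = suc (κ ℕ.+ κ) ℕ.* w

  S : ℕ → ℚ
  S κ = R (first κ) (len κ)

  κ≤first : ∀ κ → κ ℕ.≤ first κ
  κ≤first κ = ℕ.≤-trans (ℕ.m≤m*n κ q) (ℕ.m≤m+n (κ ℕ.* q) v)

  -- The extra terms at the two ends are Riemann sums of 1/x with p and with q midpoints
  -- over the same interval; both are compared with the one with pq midpoints.
  S-suc-≤ : ∀ κ → let b = r (first κ) in S (suc κ) ≤ S κ + ι q * (b * (b * b))
  -- `Q`, the q terms that leave at the bottom, is added to both sides so that the two sums start at
  -- the same place.
  S-suc-≤ κ = subst₂ _≤_ (e₁ Q (S (suc κ))) (e₂ Q (S κ) (ι q * (b * (b * b)))) (ℚ.+-monoˡ-≤ (- Q) (begin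
    Q + S (suc κ)
      ≡⟨ cong (λ i → Q + R i (len (suc κ))) (n₁ κ v) ⟨
    Q + R (first κ ℕ.+ q) (len (suc κ))
      ≡⟨ R-++ (first κ) q (len (suc κ)) ⟨
    R (first κ) (q ℕ.+ len (suc κ))
      ≡⟨ cong (R (first κ)) (n₂ κ v w) ⟩
    R (first κ) (len κ ℕ.+ p)
      ≡⟨ R-++ (first κ) (len κ) p ⟩
    S κ + R (first κ ℕ.+ len κ) p
      ≡⟨ cong (λ i → S κ + R i p) (n₃ κ v w) ⟩
    S κ + R (κ ℕ.* p ℕ.+ u) p
      ≤⟨ ℚ.+-monoʳ-≤ (S κ) (refine-lower v p (κ ℕ.* p ℕ.+ u)) ⟩
    S κ + R ((κ ℕ.* p ℕ.+ u) ℕ.* q ℕ.+ v) (p ℕ.* q)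
      ≡⟨ cong₂ (λ i j → S κ + R i j) (n₄ κ v w) (ℕ.*-comm p q) ⟩
    S κ + R (first κ ℕ.* p ℕ.+ u) (q ℕ.* p)
      ≤⟨ ℚ.+-monoʳ-≤ (S κ) (refine-upper u q (first κ) b ℚ.≤-refl) ⟩
    S κ + (Q + ι q * (b * (b * b))) ∎))
    where
    open ℚ.≤-Reasoning
    b = r (first κ)
    Q = R (first κ) q
    e₁ : ∀ Q x → Q + x - Q ≡ x
    e₁ = solve-∀ ℚ-ring
    e₂ : ∀ Q x y → x + (Q + y) - Q ≡ x + y
    e₂ = solve-∀ ℚ-ring
    n₁ : ∀ κ v → κ ℕ.* suc (v ℕ.+ v) ℕ.+ v ℕ.+ suc (v ℕ.+ v) ≡ suc κ ℕ.* suc (v ℕ.+ v) ℕ.+ v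
    n₁ = ℕ-Solver.solve-∀
    n₂ : ∀ κ v w → suc (v ℕ.+ v) ℕ.+ suc (suc κ ℕ.+ suc κ) ℕ.* w ≡
      suc (κ ℕ.+ κ) ℕ.* w ℕ.+ suc ((v ℕ.+ w) ℕ.+ (v ℕ.+ w))
    n₂ = ℕ-Solver.solve-∀
    n₃ : ∀ κ v w → κ ℕ.* suc (v ℕ.+ v) ℕ.+ v ℕ.+ suc (κ ℕ.+ κ) ℕ.* w ≡
      κ ℕ.* suc ((v ℕ.+ w) ℕ.+ (v ℕ.+ w)) ℕ.+ (v ℕ.+ w)
    n₃ = ℕ-Solver.solve-∀
    n₄ : ∀ κ v w → (κ ℕ.* suc ((v ℕ.+ w) ℕ.+ (v ℕ.+ w)) ℕ.+ (v ℕ.+ w)) ℕ.* suc (v ℕ.+ v) ℕ.+ v ≡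
      (κ ℕ.* suc (v ℕ.+ v) ℕ.+ v) ℕ.* suc ((v ℕ.+ w) ℕ.+ (v ℕ.+ w)) ℕ.+ (v ℕ.+ w)
    n₄ = ℕ-Solver.solve-∀

  -- Let n = `first κ`. If `S κ` < 1, `E-lower` gives (n+1+len)/(n+1) ≤ e, so (n+1)η ≤ (n+1)(p - q
  -- e) ≤ 2(n+1)w - len q. The last expression is exactly w, because 2(n+1) = K q + 1 and len = K w.
  -- This fails once η κ ≥ w.
  S-large : ∀ {η N} → 0ℚ < η →
    (∀ J → η ≤ ι 2 * ι w - (E (J ℕ.+ N) 1ℚ - 1ℚ) * ι q) →
    ∃[ κ₁ ] (∀ κ → κ₁ ℕ.≤ κ → 1ℚ ≤ S κ)
  S-large {η} {N} 0<η H = κ₁ , large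
    where
    κ₁ = proj₁ (archimedean-* (ι w) η 0<η)
    large : ∀ κ → κ₁ ℕ.≤ κ → 1ℚ ≤ S κ
    large κ κ₁≤κ with 1ℚ ℚ.≤? S κ
    ... | yes 1≤S = 1≤S
    ... | no 1≰S = contradiction (ι-cancel {suc n} {n} (*-cancelʳ 0<η (begin
      ι (suc n) * η
        -- `E-lower` starts from one term of the series and adds one per summand; hence this
        -- truncation index.
        ≤⟨ *-monoʳ (ι≥0 (suc n)) (H (len κ ℕ.+ 1)) ⟩
      L * (ι 2 * ι w - (e - 1ℚ) * ι q)
        ≡⟨ e₁ L (ι w) e (ι q) ⟩
      ι 2 * L * ι w - (L * e - L) * ι q
        ≤⟨ ℚ.+-monoʳ-≤ (ι 2 * L * ι w) (ℚ.neg-antimono-≤ (*-monoˡ (ι≥0 q) (ℚ.+-monoˡ-≤ (- L) key))) ⟩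
      ι 2 * L * ι w - (ι (suc n ℕ.+ len κ) - L) * ι q
        ≡⟨ cong (λ y → ι 2 * L * ι w - (y - L) * ι q) (ι-+ (suc n) (len κ)) ⟩
      ι 2 * L * ι w - (L + ι (len κ) - L) * ι q
        ≡⟨ cong₂ (λ x y → ι 2 * (1ℚ + x) * ι w - ((1ℚ + x) + y - (1ℚ + x)) * ι q)
             (trans (ι-rec κ q v) (cong (λ y → ι κ * y + ι v) ιq))
             (trans (ι-* (suc (κ ℕ.+ κ)) w) (cong (λ y → (1ℚ + y) * ι w) (ι-+ κ κ))) ⟩
      ι 2 * L′ * ι w - (L′ + (1ℚ + (ι κ + ι κ)) * ι w - L′) * ι q
        ≡⟨ cong (λ y → ι 2 * L′ * ι w - (L′ + (1ℚ + (ι κ + ι κ)) * ι w - L′) * y) ιq ⟩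
      ι 2 * L′ * ι w - (L′ + (1ℚ + (ι κ + ι κ)) * ι w - L′) * (1ℚ + (ι v + ι v))
        ≡⟨ e₂ (ι κ) (ι v) (ι w) ⟩
      ι w
        ≤⟨ proj₂ (archimedean-* (ι w) η 0<η) ⟩
      η * ι κ₁
        ≤⟨ *-monoʳ (ℚ.<⇒≤ 0<η) (ι-mono (ℕ.≤-trans κ₁≤κ (κ≤first κ))) ⟩
      η * ι n
        ≡⟨ ℚ.*-comm η (ι n) ⟩
      ι n * η ∎))) ℕ.1+n≰n
      where
      open ℚ.≤-Reasoning
      n = first κ
      L = ι (suc n)
      e = E ((len κ ℕ.+ 1) ℕ.+ N) 1ℚ
      ιq : ι q ≡ 1ℚ + (ι v + ι v)
      ιq = cong (_+_ 1ℚ) (ι-+ v v)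
      L′ = 1ℚ + (ι κ * (1ℚ + (ι v + ι v)) + ι v)
      S≤1 : 0ℚ + S κ ≤ 1ℚ
      S≤1 = subst (_≤ 1ℚ) (sym (ℚ.+-identityˡ (S κ))) (ℚ.<⇒≤ (ℚ.≰⇒> 1≰S))
      key : ι (suc n ℕ.+ len κ) ≤ L * e
      key = begin
        ι (suc n ℕ.+ len κ)                    ≡⟨ ℚ.*-identityʳ (ι (suc n ℕ.+ len κ)) ⟨
        ι (suc n ℕ.+ len κ) * E 1 0ℚ           ≤⟨ E-lower (len κ) n 1 0ℚ ℚ.≤-refl ⟩
        L * E (len κ ℕ.+ 1) (0ℚ + S κ)
          ≤⟨ *-monoʳ (ι≥0 (suc n)) (ℚ.≤-trans
               (E-mono (len κ ℕ.+ 1) (+-≥0 ℚ.≤-refl (R≥0 n (len κ))) S≤1)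
               (E-mono-index N (len κ ℕ.+ 1) 0≤1)) ⟩
        L * E (N ℕ.+ (len κ ℕ.+ 1)) 1ℚ         ≡⟨ cong (λ i → L * E i 1ℚ) (ℕ.+-comm N (len κ ℕ.+ 1)) ⟩
        L * e                                  ∎
      e₁ : ∀ L w e q → L * (ι 2 * w - (e - 1ℚ) * q) ≡ ι 2 * L * w - (L * e - L) * q
      e₁ = solve-∀ ℚ-ring
      e₂ : ∀ κ v w → let L = 1ℚ + (κ * (1ℚ + (v + v)) + v) in
        ι 2 * L * w - (L + (1ℚ + (κ + κ)) * w - L) * (1ℚ + (v + v)) ≡ w
      e₂ = solve-∀ ℚ-ring


  -- With M = K p, N = K q and ρ = 1/(T+1), `E-upper` turns 1 ≤ `S κ` into e/M + len ρ⁴/24 ≤ 1/N.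
  -- Hence len ρ⁴ M N ≤ 24 K (p - q e) ≤ 48 K/q′, which is then cleared of denominators.
  S≥1⇒ : ∀ κ J q′ → 1ℚ ≤ S κ →
    (ι 2 * ι w - (E (4 ℕ.+ J) 1ℚ - 1ℚ) * ι q) * ι q′ ≤ ι 2 →
    let κ′ = suc (κ ℕ.+ κ) ; T = first κ ℕ.+ len κ in
    len κ ℕ.* suc (T ℕ.+ T) ℕ.* (κ′ ℕ.* q) ℕ.* q′ ℕ.≤
    48 ℕ.* κ′ ℕ.* (suc T ℕ.* suc T ℕ.* (suc T ℕ.* suc T))
  S≥1⇒ κ J q′ 1≤S H = ι-cancel (begin
    ι (len κ ℕ.* M ℕ.* (κ′ ℕ.* q) ℕ.* q′)
      ≡⟨ trans (ι-* (len κ ℕ.* M ℕ.* (κ′ ℕ.* q)) q′) (cong (_* ι q′)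
           (trans (ι-* (len κ ℕ.* M) (κ′ ℕ.* q)) (cong (_* ι (κ′ ℕ.* q)) (ι-* (len κ) M)))) ⟩
    ι (len κ) * ι M * ι (κ′ ℕ.* q) * ι q′
      ≡⟨ trans (e₀ (ι (len κ) * ι M * ι (κ′ ℕ.* q) * ι q′))
           (cong (λ x → ι (len κ) * ι M * ι (κ′ ℕ.* q) * ι q′ * ((x * x) * (x * x))) (sym (ι-r T))) ⟩
    ι (len κ) * ι M * ι (κ′ ℕ.* q) * ι q′ * ((X * ρ * (X * ρ)) * (X * ρ * (X * ρ)))
      ≡⟨ e₁ (ι (len κ)) (ι M) (ι (κ′ ℕ.* q)) (ι q′) X ρ ⟩
    ι (len κ) * ρ⁴ * (ι M * ι (κ′ ℕ.* q)) * (ι q′ * X⁴)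
      ≤⟨ *-monoˡ (*-≥0 (ι≥0 q′) (*-≥0 (*-≥0 0≤X 0≤X) (*-≥0 0≤X 0≤X))) step₁ ⟩
    ι 24 * (ι M - e * ι (κ′ ℕ.* q)) * (ι q′ * X⁴)
      ≡⟨ cong₂ (λ x y → ι 24 * (x - e * y) * (ι q′ * X⁴))
           (trans (cong ι (n₁ κ v w)) (trans (ι-* κ′ (q ℕ.+ 2 ℕ.* w))
             (cong (_*_ (ι κ′)) (trans (ι-+ q (2 ℕ.* w)) (cong (_+_ (ι q)) (ι-* 2 w))))))
           (ι-* κ′ q) ⟩
    ι 24 * (ι κ′ * (ι q + ι 2 * ι w) - e * (ι κ′ * ι q)) * (ι q′ * X⁴)
      ≡⟨ e₂ (ι κ′) (ι q) (ι w) e (ι q′) X⁴ ⟩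
    ι 24 * ι κ′ * X⁴ * ((ι 2 * ι w - (e - 1ℚ) * ι q) * ι q′)
      ≤⟨ *-monoʳ (*-≥0 (*-≥0 (ι≥0 24) (ι≥0 κ′)) (*-≥0 (*-≥0 0≤X 0≤X) (*-≥0 0≤X 0≤X))) H ⟩
    ι 24 * ι κ′ * X⁴ * ι 2
      ≡⟨ e₃ (ι κ′) X⁴ ⟩
    ι 48 * ι κ′ * X⁴
      ≡⟨ cong₂ _*_ (sym (ι-* 48 κ′)) (trans (cong₂ _*_ (sym (ι-* (suc T) (suc T))) (sym (ι-* (suc T) (suc T))))
           (sym (ι-* (suc T ℕ.* suc T) (suc T ℕ.* suc T)))) ⟩
    ι (48 ℕ.* κ′) * ι (suc T ℕ.* suc T ℕ.* (suc T ℕ.* suc T))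
      ≡⟨ ι-* (48 ℕ.* κ′) (suc T ℕ.* suc T ℕ.* (suc T ℕ.* suc T)) ⟨
    ι (48 ℕ.* κ′ ℕ.* (suc T ℕ.* suc T ℕ.* (suc T ℕ.* suc T))) ∎)
    where
    open ℚ.≤-Reasoning
    κ′ = suc (κ ℕ.+ κ)
    n = first κ
    T = n ℕ.+ len κ
    M = suc (T ℕ.+ T)
    N = suc (n ℕ.+ n)
    e = E (4 ℕ.+ J) 1ℚ
    ρ = r T
    ρ⁴ = (ρ * ρ) * (ρ * ρ)
    X = ι (suc T)
    X⁴ = (X * X) * (X * X)
    0≤X : 0ℚ ≤ X
    0≤X = ι≥0 (suc T)
    n₀ : ∀ κ v → suc ((κ ℕ.* suc (v ℕ.+ v) ℕ.+ v) ℕ.+ (κ ℕ.* suc (v ℕ.+ v) ℕ.+ v)) ≡ suc (κ ℕ.+ κ) ℕ.* suc (v ℕ.+ v)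
    n₀ = ℕ-Solver.solve-∀
    n₁ : ∀ κ v w → let T = κ ℕ.* suc (v ℕ.+ v) ℕ.+ v ℕ.+ suc (κ ℕ.+ κ) ℕ.* w in
      suc (T ℕ.+ T) ≡ suc (κ ℕ.+ κ) ℕ.* (suc (v ℕ.+ v) ℕ.+ 2 ℕ.* w)
    n₁ = ℕ-Solver.solve-∀
    e₀ : ∀ x → x ≡ x * ((1ℚ * 1ℚ) * (1ℚ * 1ℚ))
    e₀ = solve-∀ ℚ-ring
    e₁ : ∀ l m n q′ X ρ → l * m * n * q′ * ((X * ρ * (X * ρ)) * (X * ρ * (X * ρ))) ≡
      l * ((ρ * ρ) * (ρ * ρ)) * (m * n) * (q′ * ((X * X) * (X * X)))
    e₁ = solve-∀ ℚ-ring
    e₂ : ∀ κ′ q w e q′ X⁴ → ι 24 * (κ′ * (q + ι 2 * w) - e * (κ′ * q)) * (q′ * X⁴) ≡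
      ι 24 * κ′ * X⁴ * ((ι 2 * w - (e - 1ℚ) * q) * q′)
    e₂ = solve-∀ ℚ-ring
    e₃ : ∀ κ′ X⁴ → ι 24 * κ′ * X⁴ * ι 2 ≡ ι 48 * κ′ * X⁴
    e₃ = solve-∀ ℚ-ring
    G : ℚ
    G = ι (len κ) * ρ⁴
    upper : ι 24 * (e * r (T ℕ.+ T)) + G ≤ ι 24 * r (n ℕ.+ n)
    upper = begin
      ι 24 * (e * r (T ℕ.+ T)) + G
        ≤⟨ ℚ.+-monoˡ-≤ G (*-monoʳ (ι≥0 24) (*-monoˡ (r≥0 (T ℕ.+ T))
             (E-mono (4 ℕ.+ J) 0≤1 (subst (1ℚ ≤_) (sym (ℚ.+-identityˡ (S κ))) 1≤S)))) ⟩
      ι 24 * (E (4 ℕ.+ J) (0ℚ + S κ) * r (T ℕ.+ T)) + G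
        ≤⟨ E-upper (len κ) n J 0ℚ ρ ℚ.≤-refl (r≥0 T) ℚ.≤-refl ⟩
      ι 24 * (E (4 ℕ.+ J) 0ℚ * r (n ℕ.+ n))
        ≡⟨ cong (_*_ (ι 24)) (trans (cong (_* r (n ℕ.+ n)) (E-at-0 (3 ℕ.+ J))) (ℚ.*-identityˡ (r (n ℕ.+ n)))) ⟩
      ι 24 * r (n ℕ.+ n) ∎
    step₁ : G * (ι M * ι (κ′ ℕ.* q)) ≤ ι 24 * (ι M - e * ι (κ′ ℕ.* q))
    step₁ = begin
      G * (ι M * ι (κ′ ℕ.* q))
        ≡⟨ cong (λ i → G * (ι M * ι i)) (n₀ κ v) ⟨
      G * (ι M * ι N)
        ≡⟨ f₁ G (ι M) (ι N) (ι 24 * (e * r (T ℕ.+ T))) ⟩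
      (ι 24 * (e * r (T ℕ.+ T)) + G) * (ι M * ι N) - ι 24 * (e * r (T ℕ.+ T)) * (ι M * ι N)
        ≤⟨ ℚ.+-monoˡ-≤ (- (ι 24 * (e * r (T ℕ.+ T)) * (ι M * ι N))) (*-monoˡ (*-≥0 (ι≥0 M) (ι≥0 N)) upper) ⟩
      ι 24 * r (n ℕ.+ n) * (ι M * ι N) - ι 24 * (e * r (T ℕ.+ T)) * (ι M * ι N)
        ≡⟨ f₂ (r (n ℕ.+ n)) (r (T ℕ.+ T)) e (ι M) (ι N) ⟩
      ι 24 * (ι M * (ι N * r (n ℕ.+ n)) - e * ι N * (ι M * r (T ℕ.+ T)))
        ≡⟨ cong₂ (λ x y → ι 24 * (ι M * x - e * ι N * y)) (ι-r (n ℕ.+ n)) (ι-r (T ℕ.+ T)) ⟩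
      ι 24 * (ι M * 1ℚ - e * ι N * 1ℚ)
        ≡⟨ cong₂ (λ x y → ι 24 * (x - y)) (ℚ.*-identityʳ (ι M)) (ℚ.*-identityʳ (e * ι N)) ⟩
      ι 24 * (ι M - e * ι N)
        ≡⟨ cong (λ i → ι 24 * (ι M - e * ι i)) (n₀ κ v) ⟩
      ι 24 * (ι M - e * ι (κ′ ℕ.* q)) ∎
      where
      f₁ : ∀ G M N x → G * (M * N) ≡ (x + G) * (M * N) - x * (M * N)
      f₁ = solve-∀ ℚ-ring
      f₂ : ∀ a b e M N → ι 24 * a * (M * N) - ι 24 * (e * b) * (M * N) ≡
        ι 24 * (M * (N * a) - e * N * (M * b))
      f₂ = solve-∀ ℚ-ring

  -- One factor T+1 is absorbed by M, the other three by 3K q, and w is at least q/2; this gives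
  -- 2592 = 2 · 48 · 3³.
  q′-bounded : ∀ κ q′ → w ℕ.≤ q → q ℕ.≤ 2 ℕ.* w →
    let κ′ = suc (κ ℕ.+ κ) ; T = first κ ℕ.+ len κ in
    len κ ℕ.* suc (T ℕ.+ T) ℕ.* (κ′ ℕ.* q) ℕ.* q′ ℕ.≤
    48 ℕ.* κ′ ℕ.* (suc T ℕ.* suc T ℕ.* (suc T ℕ.* suc T)) →
    q′ ℕ.≤ 2592 ℕ.* (κ′ ℕ.* κ′) ℕ.* q
  q′-bounded κ q′ w≤q q≤2w H = ℕ.*-cancelˡ-≤ (κ′ ℕ.* κ′ ℕ.* (q ℕ.* q) ℕ.* M) (begin
    κ′ ℕ.* κ′ ℕ.* (q ℕ.* q) ℕ.* M ℕ.* q′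
      ≤⟨ ℕ.*-monoˡ-≤ q′ (ℕ.*-monoˡ-≤ M (ℕ.*-monoʳ-≤ (κ′ ℕ.* κ′) (ℕ.*-monoˡ-≤ q q≤2w))) ⟩
    κ′ ℕ.* κ′ ℕ.* (2 ℕ.* w ℕ.* q) ℕ.* M ℕ.* q′
      ≡⟨ n₂ κ′ w q M q′ ⟩
    2 ℕ.* (κ′ ℕ.* w ℕ.* M ℕ.* (κ′ ℕ.* q) ℕ.* q′)
      ≤⟨ ℕ.*-monoʳ-≤ 2 H ⟩
    2 ℕ.* (48 ℕ.* κ′ ℕ.* (suc T ℕ.* suc T ℕ.* (suc T ℕ.* suc T)))
      ≤⟨ ℕ.*-monoʳ-≤ 2 (ℕ.*-monoʳ-≤ (48 ℕ.* κ′)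
           (ℕ.*-mono-≤ (ℕ.*-mono-≤ T≤M T≤Y) (ℕ.*-mono-≤ T≤Y T≤Y))) ⟩
    2 ℕ.* (48 ℕ.* κ′ ℕ.* (M ℕ.* Y ℕ.* (Y ℕ.* Y)))
      ≡⟨ n₃ κ′ M q ⟩
    κ′ ℕ.* κ′ ℕ.* (q ℕ.* q) ℕ.* M ℕ.* (2592 ℕ.* (κ′ ℕ.* κ′) ℕ.* q) ∎)
    where
    open ℕ.≤-Reasoning
    κ′ = suc (κ ℕ.+ κ)
    T = first κ ℕ.+ len κ
    M = suc (T ℕ.+ T)
    Y = κ′ ℕ.* (q ℕ.+ 2 ℕ.* q)
    n₁ : ∀ κ v w → let T = κ ℕ.* suc (v ℕ.+ v) ℕ.+ v ℕ.+ suc (κ ℕ.+ κ) ℕ.* w in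
      suc (T ℕ.+ T) ≡ suc (κ ℕ.+ κ) ℕ.* (suc (v ℕ.+ v) ℕ.+ 2 ℕ.* w)
    n₁ = ℕ-Solver.solve-∀
    n₂ : ∀ κ w q M q′ → κ ℕ.* κ ℕ.* (2 ℕ.* w ℕ.* q) ℕ.* M ℕ.* q′ ≡ 2 ℕ.* (κ ℕ.* w ℕ.* M ℕ.* (κ ℕ.* q) ℕ.* q′)
    n₂ = ℕ-Solver.solve-∀
    n₃ : ∀ κ M q → let Y = κ ℕ.* (q ℕ.+ 2 ℕ.* q) in
      2 ℕ.* (48 ℕ.* κ ℕ.* (M ℕ.* Y ℕ.* (Y ℕ.* Y))) ≡ κ ℕ.* κ ℕ.* (q ℕ.* q) ℕ.* M ℕ.* (2592 ℕ.* (κ ℕ.* κ) ℕ.* q)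
    n₃ = ℕ-Solver.solve-∀
    T≤M : suc T ℕ.≤ M
    T≤M = ℕ.s≤s (ℕ.m≤m+n T T)
    T≤Y : suc T ℕ.≤ Y
    T≤Y = ℕ.≤-trans T≤M (ℕ.≤-trans (ℕ.≤-reflexive (n₁ κ v w))
      (ℕ.*-monoʳ-≤ κ′ (ℕ.+-monoʳ-≤ q (ℕ.*-monoʳ-≤ 2 w≤q))))

  -- The next starting index n′ is at most 3(n+1), so 1/(n+1)² ≤ 9Z; the remaining q/(n+1) is at
  -- most 1/κ, and 9/κ ≤ ε.
  S-suc-excess : ∀ ε κ Z → 0ℚ ≤ ε → 0ℚ ≤ Z → ι 9 ≤ ε * ι κ →
    let n′ = suc (first (suc κ)) in ι (n′ ℕ.* n′) * Z ≡ 1ℚ →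
    ι q * (r (first κ) * (r (first κ) * r (first κ))) ≤ ε * Z
  S-suc-excess ε κ Z 0≤ε 0≤Z 9≤εκ n′²Z≡1 = begin
    ι q * (b * (b * b))
      ≡⟨ trans (sym (ℚ.*-identityʳ (ι q * (b * (b * b))))) (cong (_*_ (ι q * (b * (b * b)))) (sym n′²Z≡1)) ⟩
    ι q * (b * (b * b)) * (ι (n′ ℕ.* n′) * Z)
      ≤⟨ *-monoʳ (*-≥0 (ι≥0 q) (*-≥0 0≤b (*-≥0 0≤b 0≤b))) (*-monoˡ 0≤Z (ι-mono (ℕ.*-mono-≤ n′≤3L n′≤3L))) ⟩
    ι q * (b * (b * b)) * (ι ((3 ℕ.* suc n) ℕ.* (3 ℕ.* suc n)) * Z)
      ≡⟨ cong (λ x → ι q * (b * (b * b)) * (x * Z))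
           (trans (ι-* (3 ℕ.* suc n) (3 ℕ.* suc n)) (cong₂ _*_ (ι-* 3 (suc n)) (ι-* 3 (suc n)))) ⟩
    ι q * (b * (b * b)) * ((ι 3 * L) * (ι 3 * L) * Z)
      ≡⟨ e₁ (ι q) b L Z ⟩
    ι 9 * ι q * (b * Z) * ((L * b) * (L * b))
      ≡⟨ cong (λ x → ι 9 * ι q * (b * Z) * (x * x)) (ι-r n) ⟩
    ι 9 * ι q * (b * Z) * (1ℚ * 1ℚ)
      ≡⟨ ℚ.*-identityʳ (ι 9 * ι q * (b * Z)) ⟩
    ι 9 * ι q * (b * Z)
      ≤⟨ *-monoˡ (*-≥0 0≤b 0≤Z) 9q≤εL ⟩
    ε * L * (b * Z)
      ≡⟨ e₂ ε L b Z ⟩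
    ε * Z * (L * b)
      ≡⟨ cong (_*_ (ε * Z)) (ι-r n) ⟩
    ε * Z * 1ℚ
      ≡⟨ ℚ.*-identityʳ (ε * Z) ⟩
    ε * Z ∎
    where
    open ℚ.≤-Reasoning
    n = first κ
    n′ = suc (first (suc κ))
    b = r n
    0≤b : 0ℚ ≤ b
    0≤b = r≥0 n
    L = ι (suc n)
    e₁ : ∀ q b L Z → q * (b * (b * b)) * ((ι 3 * L) * (ι 3 * L) * Z) ≡ ι 9 * q * (b * Z) * ((L * b) * (L * b))
    e₁ = solve-∀ ℚ-ring
    e₂ : ∀ ε L b Z → ε * L * (b * Z) ≡ ε * Z * (L * b)
    e₂ = solve-∀ ℚ-ring
    n₁ : ∀ k v → 3 ℕ.* suc (k ℕ.+ v) ≡ suc (suc (v ℕ.+ v) ℕ.+ k ℕ.+ v) ℕ.+ (1 ℕ.+ k ℕ.+ k)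
    n₁ = ℕ-Solver.solve-∀
    n′≤3L : n′ ℕ.≤ 3 ℕ.* suc n
    n′≤3L = subst (n′ ℕ.≤_) (sym (n₁ (κ ℕ.* q) v)) (ℕ.m≤m+n n′ (1 ℕ.+ κ ℕ.* q ℕ.+ κ ℕ.* q))
    9q≤εL : ι 9 * ι q ≤ ε * L
    9q≤εL = begin
      ι 9 * ι q            ≤⟨ *-monoˡ (ι≥0 q) 9≤εκ ⟩
      ε * ι κ * ι q        ≡⟨ trans (ℚ.*-assoc ε (ι κ) (ι q)) (cong (_*_ ε) (sym (ι-* κ q))) ⟩
      ε * ι (κ ℕ.* q)      ≤⟨ *-monoʳ 0≤ε (ι-mono (ℕ.≤-trans (ℕ.m≤m+n (κ ℕ.* q) v) (ℕ.n≤1+n n))) ⟩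
      ε * L                ∎

-- The approximants from above, and where their sums cross 1

module Pade (i : ℕ) = Family (padeV (suc (double i))) (padeW (suc (double i)))

-- An odd index puts p/q above e, the sign that `S-large` requires.
pade-S-large : ∀ i → ∃[ κ₁ ] (∀ κ → κ₁ ℕ.≤ κ → 1ℚ ≤ Pade.S i κ)
pade-S-large i = Pade.S-large i (proj₁ (proj₂ sign))
  (λ J → ℚ.≤-trans (proj₂ (proj₂ (proj₂ sign)) J)
    (ℚ.≤-reflexive (padeError-odd i (E (J ℕ.+ proj₁ (proj₂ (proj₂ sign))) 1ℚ - 1ℚ))))
  where
  sign = padeError-bounded-below (suc (double i))

-- The next approximant lies below the truncation of e, so the excess of p/q is at most the gap
-- between the two neighbours, which the determinant evaluates to 2/(q q′).
pade-excess : ∀ i → ∃[ J ] let k = suc (double i) in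
  (ι 2 * ι (padeW k) - (E (4 ℕ.+ J) 1ℚ - 1ℚ) * ι (padeQ k)) * ι (padeQ (suc k)) ≤ ι 2
pade-excess i = N , ≤-from-+ (*-≥0 (ι≥0 (padeQ k)) 0≤excess)
      (begin
      (ι 2 * w - z * q) * q′ + q * (z * q′ - ι 2 * w′)  ≡⟨ e₁ w q w′ q′ z ⟩
      ι 2 * (w * q′ - w′ * q)                          ≡⟨ cong (λ x → ι 2 * (x - w′ * q)) det ⟩
      ι 2 * ((w′ * q + 1ℚ) - w′ * q)                   ≡⟨ e₂ (w′ * q) ⟩
      ι 2                                              ∎)
  where
  open ≡-Reasoning
  k = suc (double i)
  sign = padeError-bounded-below (suc k)
  N = proj₁ (proj₂ (proj₂ sign))
  w = ι (padeW k)
  q = ι (padeQ k)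
  w′ = ι (padeW (suc k))
  q′ = ι (padeQ (suc k))
  z = E (4 ℕ.+ N) 1ℚ - 1ℚ
  0≤excess : 0ℚ ≤ z * q′ - ι 2 * w′
  0≤excess = ℚ.≤-trans (ℚ.<⇒≤ (proj₁ (proj₂ sign)))
    (ℚ.≤-trans (proj₂ (proj₂ (proj₂ sign)) 4) (ℚ.≤-reflexive (padeError-even (suc i) z)))
  det : w * q′ ≡ w′ * q + 1ℚ
  det = trans (sym (ι-* (padeW k) (padeQ (suc k))))
    (trans (cong ι (det-odd i)) (ι-rec (padeW (suc k)) (padeQ k) 1))
  e₁ : ∀ w q w′ q′ z → (ι 2 * w - z * q) * q′ + q * (z * q′ - ι 2 * w′) ≡ ι 2 * (w * q′ - w′ * q)
  e₁ = solve-∀ ℚ-ring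
  e₂ : ∀ x → ι 2 * ((x + 1ℚ) - x) ≡ ι 2
  e₂ = solve-∀ ℚ-ring

-- Here the growing coefficients decide: q′ is at least (8i+6) q, whereas 1 ≤ S would force q′ ≤ i
-- q.
pade-S<1 : ∀ κ i → let κ′ = suc (κ ℕ.+ κ) in 2592 ℕ.* (κ′ ℕ.* κ′) ℕ.≤ i → ¬ (1ℚ ≤ Pade.S i κ)
pade-S<1 κ i H 1≤S = contradiction (ℕ.*-cancelʳ-≤ c i (padeQ k) (begin
  c ℕ.* padeQ k                          ≤⟨ ℕ.m≤m+n (c ℕ.* padeQ k) (padeQ (double i)) ⟩
  c ℕ.* padeQ k ℕ.+ padeQ (double i)     ≡⟨ padeQ-rec (double i) ⟨
  padeQ (suc k)                          ≤⟨ Pade.q′-bounded i κ (padeQ (suc k)) (padeW≤padeQ k) (padeQ≤2padeW (double i))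
                                             (Pade.S≥1⇒ i κ (proj₁ (pade-excess i)) (padeQ (suc k)) 1≤S
                                               (proj₂ (pade-excess i))) ⟩
  2592 ℕ.* (κ′ ℕ.* κ′) ℕ.* padeQ k       ≤⟨ ℕ.*-monoˡ-≤ (padeQ k) H ⟩
  i ℕ.* padeQ k                          ∎)) (ℕ.<⇒≱ i<c)
  where
  open ℕ.≤-Reasoning
  κ′ = suc (κ ℕ.+ κ)
  k = suc (double i)
  c = 4 ℕ.* double i ℕ.+ 6
  i<c : i ℕ.< c
  i<c = ℕ.≤-<-trans (i≤double i) (ℕ.≤-<-trans (ℕ.m≤m+n (double i) (3 ℕ.* double i))
    (ℕ.m<m+n (4 ℕ.* double i) (ℕ.s≤s ℕ.z≤n)))

-- A discrete intermediate value: the search descends from `d + m` and stops at the first value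
-- below 1, at the latest at `m`.
crossing : (f : ℕ → ℚ) → ∀ d m → ¬ (1ℚ ≤ f m) → 1ℚ ≤ f (d ℕ.+ m) →
  ∃[ κ ] (m ℕ.≤ κ × ¬ (1ℚ ≤ f κ) × 1ℚ ≤ f (suc κ))
crossing f zero    m f<1 1≤f = contradiction 1≤f f<1
crossing f (suc d) m f<1 1≤f with 1ℚ ℚ.≤? f (d ℕ.+ m)
... | yes 1≤f′ = crossing f d m f<1 1≤f′
... | no  f′<1 = d ℕ.+ m , ℕ.m≤n+m m d , f′<1 , 1≤f

-- The sum starts at n+1, and `Z` is 1/(n+1)² given by its equation, which leaves its representation
-- as a fraction open. `B` is the bound that puts the pair outside a given list.
Solves : ℚ → ℕ → ℕ → ℕ → Set
Solves ε B n k = B ℕ.< n × 1ℚ ≤ R n k ×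
  (∀ Z → 0ℚ ≤ Z → ι (suc n ℕ.* suc n) * Z ≡ 1ℚ → R n k ≤ 1ℚ + ε * Z)

module _ (ε : ℚ) (0<ε : 0ℚ < ε) (B : ℕ) where
  private
    κ₀ κ₀′ : ℕ
    -- The first summand ensures 9 ≤ ε κ₀, the second pushes the starting index beyond `B`.
    κ₀ = proj₁ (archimedean-* (ι 9) ε 0<ε) ℕ.+ B
    κ₀′ = suc (κ₀ ℕ.+ κ₀)

  crossing⇒solution : ∀ i → let open Pade i in
    ∃[ κ ] (κ₀ ℕ.≤ κ × ¬ (1ℚ ≤ S κ) × 1ℚ ≤ S (suc κ)) → ∃[ n ] ∃[ k ] Solves ε B n k
  crossing⇒solution i (κ , κ₀≤κ , S<1 , 1≤S) = first (suc κ) , len (suc κ) ,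
    ℕ.<-≤-trans (ℕ.s≤s (ℕ.≤-trans (ℕ.m≤n+m B _) κ₀≤κ)) (κ≤first (suc κ)) ,
    1≤S ,
    λ Z 0≤Z n²Z≡1 → ℚ.≤-trans (S-suc-≤ κ) (ℚ.+-mono-≤ (ℚ.<⇒≤ (ℚ.≰⇒> S<1))
      (S-suc-excess ε κ Z (ℚ.<⇒≤ 0<ε) 0≤Z 9≤εκ n²Z≡1))
    where
    open Pade i
    9≤εκ : ι 9 ≤ ε * ι κ
    9≤εκ = ℚ.≤-trans (proj₂ (archimedean-* (ι 9) ε 0<ε))
      (*-monoʳ (ℚ.<⇒≤ 0<ε) (ι-mono (ℕ.≤-trans (ℕ.m≤m+n _ B) κ₀≤κ)))

  -- The order of choices matters: κ₀ depends on ε and `B` only, `i` is then large enough for the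
  -- sum at κ₀ to be below 1, and κ₁ depends on `i`. The crossing therefore lies above κ₀.
  solution-from : ∀ i → 2592 ℕ.* (κ₀′ ℕ.* κ₀′) ℕ.≤ i → ∃[ n ] ∃[ k ] Solves ε B n k
  solution-from i H = crossing⇒solution i
    (crossing S κ₁ κ₀ (pade-S<1 κ₀ i H) (proj₂ (pade-S-large i) (κ₁ ℕ.+ κ₀) (ℕ.m≤m+n κ₁ κ₀)))
    where
    open Pade i
    κ₁ = proj₁ (pade-S-large i)

  solution : ∃[ n ] ∃[ k ] Solves ε B n k
  solution = solution-from (2592 ℕ.* (κ₀′ ℕ.* κ₀′)) ℕ.≤-refl

-- Leaving a finite list, and passage to the reals

bound : List (ℕ⁺ × ℕ⁺) → ℕ
bound []             = 0
bound ((m , n) ∷ xs) = value n ℕ.+ bound xs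

∈⇒≤bound : ∀ {m n} xs → (m , n) ∈ xs → value n ℕ.≤ bound xs
∈⇒≤bound ((m , n) ∷ xs) (here refl) = ℕ.m≤m+n (value n) (bound xs)
∈⇒≤bound ((m , n) ∷ xs) (there ∈xs) = ℕ.≤-trans (∈⇒≤bound xs ∈xs) (ℕ.m≤n+m (bound xs) (value n))

theorem1 : (c : ℝ) → 0ℝ <ℝ c →
    InfinitelyMany {A = ℕ⁺ × ℕ⁺} λ (m , n) →
    (1ℝ ≤ℝ fromℚ ∑1/ℓ[ℓ= n ⋯ m ]) ×
    (fromℚ ∑1/ℓ[ℓ= n ⋯ m ] ≤ℝ 1ℝ +ℝ c /ℝ (n ^⁺ 2))
-- Positivity of `c` supplies a rational ε that its sequence dominates from index `N` on, so the
-- rational problem is solved for ε.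
theorem1 c (ε , 0<ε , N , ε≤c) xs = from-solution (solution ε 0<ε (bound xs))
  where
  P : ℕ⁺ × ℕ⁺ → Set
  P (m , n) = (1ℝ ≤ℝ fromℚ ∑1/ℓ[ℓ= n ⋯ m ]) × (fromℚ ∑1/ℓ[ℓ= n ⋯ m ] ≤ℝ 1ℝ +ℝ c /ℝ (n ^⁺ 2))

  ≤-+ : ∀ {x y δ} → 0ℚ < δ → x ≤ y → x ≤ y + δ
  ≤-+ 0<δ x≤y = ℚ.≤-trans x≤y (≤-from-+ (ℚ.<⇒≤ 0<δ) refl)

  from-solution : ∃[ n ] ∃[ k ] Solves ε (bound xs) n k → ∃[ x ] (x ∉ xs × P x)
  from-solution (n , k , B<n , 1≤R , R≤) = (m⁺ , n⁺) ,
    (λ ∈xs → ℕ.<⇒≱ B<n (ℕ.≤-trans (ℕ.n≤1+n n) (∈⇒≤bound xs ∈xs))) ,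
    (λ δ 0<δ → 0 , λ _ _ → ≤-+ 0<δ (subst (1ℚ ≤_) (sym sum≡R) 1≤R)) ,
    (λ δ 0<δ → N , λ i N≤i → ≤-+ 0<δ (subst (_≤ 1ℚ + seq c i * Z) (sym sum≡R)
      (ℚ.≤-trans (R≤ Z 0≤Z n²Z≡1) (ℚ.+-monoʳ-≤ 1ℚ (*-monoˡ 0≤Z
        (subst (_≤ seq c i) (ℚ.+-identityˡ ε) (ε≤c i N≤i)))))))
    where
    n⁺ m⁺ : ℕ⁺
    n⁺ = mkℕ⁺ (suc n)
    -- The k terms start at 1/(n+1), so the last index is n + k.
    m⁺ = mkℕ⁺ (n ℕ.+ k) {{ℕ.>-nonZero (ℕ.≤-trans (ℕ.≤-trans (ℕ.s≤s ℕ.z≤n) B<n) (ℕ.m≤m+n n k))}}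
    sum≡R : ∑1/ℓ[ℓ= n⁺ ⋯ m⁺ ] ≡ R n k
    sum≡R = cong (R n) (ℕ.m+n∸m≡n n k)
    Z = 1/⁺ (n⁺ ^⁺ 2)
    -- Written exactly as the predecessor of `suc n ℕ.^ 2` reduces, so that `Z` is `r pred-n²` by
    -- computation.
    pred-n² = n ℕ.* 1 ℕ.+ n ℕ.* (suc n ℕ.* 1)
    0≤Z : 0ℚ ≤ Z
    0≤Z = r≥0 pred-n²
    n²Z≡1 : ι (suc n ℕ.* suc n) * Z ≡ 1ℚ
    n²Z≡1 = trans (cong (λ x → ι x * Z) (cong (suc n ℕ.*_) (sym (ℕ.*-identityʳ (suc n))))) (ι-r pred-n²)
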